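{- Let $k\geq 4$ and $n>k$ be integers. If $G$ is a $2$-connected graph on $n$ vertices with chromatic number $\chi(G)=k$ and clique number $\omega(G)=k$, then for every integer $x\geq k$, $$P(G,x)\leq (x-1)_{k-1}\big((x-1)^{n-k+1}+(-1)^{n-k}\big),$$ with equality if and only if $G\cong G_{n,k}$.
   Context: All graphs are finite and simple. $P(G,x)$ denotes the chromatic polynomial of $G$, i.e., for a positive integer $x$ the number of proper colorings $c:V(G)\to\{1,\dots,x\}$. $(x)_m=x(x-1)\cdots(x-m+1)$ denotes the falling factorial. $G_{n,k}$ is the graph on $n$ vertices obtained from a $k$-clique by adding a path with $n-k$ new internal vertices (each of degree $2$) whose two endpoints are two distinct vertices of the clique. -}

module Defs where

open import Data.Bool using (Bool; true; false; _∧_; _∨_; not)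
open import Data.Bool.Properties using (∨-comm)
open import Data.Nat using (ℕ; zero; suc; _+_; _*_; _∸_; _≤_; _<_; _≡ᵇ_; _<ᵇ_; _≤ᵇ_)
open import Data.Fin using (Fin; toℕ)
open import Data.Fin.Properties using (all?)
open import Data.Vec using (Vec; []; _∷_; lookup)
open import Data.List using (List; []; _∷_; [_]; map; concatMap; filter; length)
open import Data.List using () renaming (_∷_ to _∷ₗ_)
open import Data.Fin using () renaming (zero to fzero)
import Data.Fin as F
open import Data.Integer as ℤ using (ℤ; +_; -[1+_])
open import Data.Product using (Σ; ∃; _×_; _,_)
open import Data.Unit using (⊤)
open import Data.Empty using (⊥)
open import Relation.Nullary using (¬_; Dec; yes; no)
open import Relation.Nullary.Decidable using (_→-dec_; ¬?)
open import Relation.Binary.PropositionalEquality using (_≡_; _≢_; refl; cong; cong₂)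
open import Function.Bundles using (_↔_; Inverse)

record Graph (n : ℕ) : Set where
  field
    adj    : Fin n → Fin n → Bool
    sym    : ∀ u v → adj u v ≡ adj v u
    irrefl : ∀ u → adj u u ≡ false
open Graph public

Adj : ∀ {n} → Graph n → Fin n → Fin n → Set
Adj G u v = adj G u v ≡ true

Proper : ∀ {n x} → Graph n → Vec (Fin x) n → Set
Proper G c = ∀ u v → Adj G u v → lookup c u ≢ lookup c v

proper? : ∀ {n x} (G : Graph n) (c : Vec (Fin x) n) → Dec (Proper G c)
proper? G c = all? λ u → all? λ v →
  (adj G u v Data.Bool.≟ true) →-dec ¬? (lookup c u Data.Fin.≟ lookup c v)

allColourings : (n x : ℕ) → List (Vec (Fin x) n)
allColourings zero    x = [ [] ]
allColourings (suc n) x =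
  concatMap (λ v → map (λ a → a ∷ v) (Data.List.allFin x)) (allColourings n x)
  where import Data.List

P : ∀ {n} → Graph n → ℕ → ℕ
P {n} G x = length (filter (proper? G) (allColourings n x))

Colourable : ∀ {n} → Graph n → ℕ → Set
Colourable {n} G x = Σ (Vec (Fin x) n) (Proper G)

ChromaticNumberIs : ∀ {n} → Graph n → ℕ → Set
ChromaticNumberIs G k = Colourable G k × (∀ m → m < k → ¬ Colourable G m)

IsClique : ∀ {n m} → Graph n → (Fin m → Fin n) → Set
IsClique G f = ∀ i j → i ≢ j → Adj G (f i) (f j)

HasClique : ∀ {n} → Graph n → ℕ → Set
HasClique {n} G m = Σ (Fin m → Fin n) λ f →
  (∀ i j → f i ≡ f j → i ≡ j) × IsClique G f

CliqueNumberIs : ∀ {n} → Graph n → ℕ → Set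
CliqueNumberIs G k = HasClique G k × (∀ m → k < m → ¬ HasClique G m)

data Walk {n} (G : Graph n) (ok : Fin n → Set) : Fin n → Fin n → Set where
  here : ∀ {u} → ok u → Walk G ok u u
  step : ∀ {u w v} → ok u → Adj G u w → Walk G ok w v → Walk G ok u v

Connected : ∀ {n} → Graph n → Set
Connected {n} G = ∀ (u v : Fin n) → Walk G (λ _ → ⊤) u v

ConnectedWithout : ∀ {n} → Graph n → Fin n → Set
ConnectedWithout G z = ∀ u v → u ≢ z → v ≢ z → Walk G (λ w → w ≢ z) u v

TwoConnected : ∀ {n} → Graph n → Set
TwoConnected {n} G = 3 ≤ n × Connected G × (∀ z → ConnectedWithout G z)

_≅_ : ∀ {n} → Graph n → Graph n → Set
_≅_ {n} G H = Σ (Fin n ↔ Fin n) λ φ →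
  ∀ u v → adj H (Inverse.to φ u) (Inverse.to φ v) ≡ adj G u v

-- The graph G_{n,k}
-- vertices 0,…,k-1 form a clique; vertices k,…,n-1 are the internal
-- vertices of the path 0 — k — k+1 — ⋯ — n-1 — 1.

private
  ≡ᵇ-sym : ∀ a b → (a ≡ᵇ b) ≡ (b ≡ᵇ a)
  ≡ᵇ-sym zero zero = refl
  ≡ᵇ-sym zero (suc b) = refl
  ≡ᵇ-sym (suc a) zero = refl
  ≡ᵇ-sym (suc a) (suc b) = ≡ᵇ-sym a b

  ≡ᵇ-refl : ∀ a → (a ≡ᵇ a) ≡ true
  ≡ᵇ-refl zero = refl
  ≡ᵇ-refl (suc a) = ≡ᵇ-refl a

GnkRaw : ℕ → ℕ → ℕ → ℕ → Bool
GnkRaw n k a b =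
  ((a <ᵇ k) ∧ (b <ᵇ k))
  ∨ ((a ≡ᵇ 0) ∧ (b ≡ᵇ k))
  ∨ ((k ≤ᵇ a) ∧ ((b ≡ᵇ suc a) ∧ (suc a <ᵇ n)))
  ∨ ((a ≡ᵇ (n ∸ 1)) ∧ (b ≡ᵇ 1))

GnkAdj : ℕ → ℕ → ℕ → ℕ → Bool
GnkAdj n k a b = not (a ≡ᵇ b) ∧ (GnkRaw n k a b ∨ GnkRaw n k b a)

Gnk : (n k : ℕ) → Graph n
Gnk n k = record
  { adj    = λ u v → GnkAdj n k (toℕ u) (toℕ v)
  ; sym    = λ u v → cong₂ _∧_ (cong not (≡ᵇ-sym (toℕ u) (toℕ v)))
                                (∨-comm (GnkRaw n k (toℕ u) (toℕ v)) (GnkRaw n k (toℕ v) (toℕ u)))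
  ; irrefl = λ u → cong₂ (λ x y → not x ∧ y) (≡ᵇ-refl (toℕ u)) refl
  }

falling : ℕ → ℕ → ℕ
falling x zero    = 1
falling x (suc m) = x * falling (x ∸ 1) m

bound : (n k x : ℕ) → ℤ
bound n k x =
  (+ falling (x ∸ 1) (k ∸ 1)) ℤ.* ((+ ((x ∸ 1) Data.Nat.^ (n ∸ k + 1))) ℤ.+ (-[1+ 0 ] ℤ.^ (n ∸ k)))

{-# OPTIONS --safe #-}

-- Grow G from a k-clique by ears. Once the clique is coloured, an ear with l inner vertices
-- can be coloured in E l ways if its ends have equal colours and in D l ways otherwise, and
-- |E l - D l| = 1. The first ear has its ends in the clique, so it contributes exactly D l;
-- a single ear with n - k inner vertices gives (x)_k D (n - k), the bound.
-- Every further ear loses, because D (m + l) = D m D l + D (m - 1) E l. The only tight case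
-- is an ear with one inner vertex added to the first ear: there D m E 1 may exceed D (m + 1)
-- by one, but at least two colourings of the first ear give the ends of the new one
-- different colours. Finally, if a single ear spans G but G has an edge outside G_{n,k}, some
-- colouring of G_{n,k} gives the ends of that edge equal colours, so the bound is not attained.
module Submission where

open import Defs
open import Data.Bool using (true; false; if_then_else_; not; _∧_; _∨_)
import Data.Bool as Bool
open import Data.Bool.Properties using (T-∧; T-∨; T-≡; ¬-not)
open import Data.Empty using (⊥-elim)
open import Data.Fin using (Fin; zero; suc; toℕ)
import Data.Fin as Fin
import Data.Fin.Properties as Fin
import Data.Integer as ℤ
import Data.Integer.Properties as ℤ
open import Data.Integer.Solver renaming (module +-*-Solver to ℤ-Solver)
open import Data.List using (List; []; _∷_; _++_; [_]; map; concatMap; filter; length; allFin)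
import Data.List as List
import Data.List.Membership.DecPropositional as DecMembership
open import Data.List.Membership.Propositional using (_∈_; _∉_)
open import Data.List.Membership.Propositional.Properties using (∈-map⁺; ∈-map⁻; ∈-++⁺ˡ; ∈-++⁺ʳ; ∈-++⁻; ∈-allFin; ∈-tabulate⁺; ∈-tabulate⁻; ∈-∃++)
open import Data.List.Membership.Propositional.Properties.WithK using (unique∧set⇒bag)
open import Data.List.Properties using (length-++; ++-assoc; length-map; length-tabulate; map-tabulate; tabulate-lookup; ∷-injective; ∷-injectiveˡ; ∷-injectiveʳ)
open import Data.List.Relation.Binary.BagAndSetEquality using (∼bag⇒↭)
open import Data.List.Relation.Binary.Permutation.Propositional as Perm using (_↭_; prep; swap)
import Data.List.Relation.Binary.Permutation.Propositional.Properties as Perm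
import Data.List.Relation.Binary.Permutation.Setoid.Properties as PermSetoid
open import Data.List.Relation.Unary.All as All using (All; []; _∷_)
import Data.List.Relation.Unary.All.Properties as All
open import Data.List.Relation.Unary.AllPairs using ([]; _∷_)
open import Data.List.Relation.Unary.Any using (here; there)
open import Data.List.Relation.Unary.Unique.Propositional using (Unique)
open import Data.List.Relation.Unary.Unique.Propositional.Properties using (allFin⁺) renaming (Unique[x∷xs]⇒x∉xs to head∉)
import Data.List.Relation.Unary.Unique.Propositional.Properties as Unique
open import Data.Nat using (ℕ; zero; suc; _+_; _*_; _∸_; _^_; _≤_; _<_; z≤n; s≤s; >-nonZero; ≤-pred; _<ᵇ_; _≤ᵇ_; _≡ᵇ_)
import Data.Nat.ListAction as ListAction
open import Data.Nat.Properties
open import Data.Nat.Solver using (module +-*-Solver)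
open import Data.Product using (∃; _×_; _,_; proj₁; proj₂)
open import Data.Sum using (_⊎_; inj₁; inj₂)
import Data.Sum as Sum
open import Data.Vec using (Vec; []; _∷_; lookup; _[_]≔_; tabulate)
import Data.Vec as Vec
open import Data.Vec.Properties using (lookup∘update; lookup∘update′; []≔-commutes; lookup∘tabulate; tabulate∘lookup; tabulate-cong)
open import Function using (_∘_; id; case_of_)
open import Function.Bundles using (_⇔_; _↔_; Inverse; mk⇔; mk↔ₛ′; module Equivalence)
open import Relation.Binary.PropositionalEquality as ≡ using (_≡_; _≢_; refl; cong; cong₂; subst; subst₂; trans; module ≡-Reasoning)
open import Relation.Nullary using (¬_; Dec; yes; no; does)
open import Relation.Nullary.Decidable using (_×-dec_; ¬?)
open import Algebra.Properties.CommutativeMonoid.Sum +-0-commutativeMonoid using (sum; sum-cong-≗; ∑-distrib-+; ∑-comm)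

-- All estimates are made for one fixed colouring of the clique with distinct colours, so the clique
-- contributes only the factor `falling x k`. An ear with `l` inner vertices added to a part counted
-- by `D m` can be coloured in at most `1 + D l` ways. In `D m * (1 + D l)` the surplus `D m` has to
-- stay below the second term `D (m - 1) * E l = (x - 1) * D (m - 1) * D (l -
-- 1)` of the addition formula, while `D m` differs from `(x - 1) * D (m -
-- 1)` by exactly one. Hence `l ≥ 2` leaves ample room and `l = 1` leaves none, which singles out
-- the one-vertex ear. Once two ears are in place the inequality is strict, and the missing unit,
-- multiplied by `D l`, pays for a further ear of any length. Four colours are what the greedy
-- arguments need: a vertex may have to avoid its predecessor, the far end of the path and one more
-- vertex.

private variable
  n x y : ℕ

-- Sums over colourings

sum-mono : ∀ {f g : Fin x → ℕ} → (∀ z → f z ≤ g z) → sum f ≤ sum g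
sum-mono {zero} f≤g = z≤n
sum-mono {suc x} f≤g = +-mono-≤ (f≤g zero) (sum-mono (f≤g ∘ suc))

sum-*ˡ : ∀ a (f : Fin x → ℕ) → sum (λ z → a * f z) ≡ a * sum f
sum-*ˡ {zero} a f = ≡.sym (*-zeroʳ a)
sum-*ˡ {suc x} a f = trans (cong (a * f zero +_) (sum-*ˡ a (f ∘ suc)))
                           (≡.sym (*-distribˡ-+ a (f zero) _))

sum-const : ∀ a → sum {x} (λ _ → a) ≡ x * a
sum-const {zero} a = refl
sum-const {suc x} a = cong (a +_) (sum-const {x} a)

term≤sum : ∀ (f : Fin x → ℕ) z → f z ≤ sum f
term≤sum f zero = m≤m+n _ _
term≤sum f (suc z) = ≤-trans (term≤sum (f ∘ suc) z) (m≤n+m _ _)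

terms≤sum : ∀ (f : Fin x → ℕ) {z w} → z ≢ w → f z + f w ≤ sum f
terms≤sum f {zero} {zero} z≢w = ⊥-elim (z≢w refl)
terms≤sum f {zero} {suc w} z≢w = +-monoʳ-≤ (f zero) (term≤sum (f ∘ suc) w)
terms≤sum f {suc z} {zero} z≢w =
  subst (_≤ sum f) (+-comm (f zero) _) (+-monoʳ-≤ (f zero) (term≤sum (f ∘ suc) z))
terms≤sum f {suc z} {suc w} z≢w =
  ≤-trans (terms≤sum (f ∘ suc) (z≢w ∘ cong suc)) (m≤n+m _ _)

ne : Fin x → Fin x → ℕ
ne a b with a Fin.≟ b
... | yes _ = 0
... | no _  = 1

eq : Fin x → Fin x → ℕ
eq a b with a Fin.≟ b
... | yes _ = 1
... | no _  = 0

ne-≢ : ∀ {a b : Fin x} → a ≢ b → ne a b ≡ 1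
ne-≢ {a = a} {b} a≢b with a Fin.≟ b
... | yes a≡b = ⊥-elim (a≢b a≡b)
... | no _ = refl

eq-refl : ∀ (a : Fin x) → eq a a ≡ 1
eq-refl a with a Fin.≟ a
... | yes _ = refl
... | no a≢a = ⊥-elim (a≢a refl)

ne-suc : ∀ (a b : Fin x) → ne (Fin.suc a) (Fin.suc b) ≡ ne a b
ne-suc a b with a Fin.≟ b
... | yes _ = refl
... | no _ = refl

sum-ne : ∀ (a : Fin x) f → sum (λ z → ne a z * f z) + f a ≡ sum f
sum-ne zero f = trans (+-comm _ (f zero))
  (cong (f zero +_) (sum-cong-≗ λ z → *-identityˡ (f (suc z))))
sum-ne (suc a) f = begin
  f zero + 0 + sum (λ z → ne (suc a) (suc z) * f (suc z)) + f (suc a)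
    ≡⟨ cong (λ s → s + sum (λ z → ne (suc a) (suc z) * f (suc z)) + f (suc a)) (+-identityʳ (f zero)) ⟩
  f zero + sum (λ z → ne (suc a) (suc z) * f (suc z)) + f (suc a)
    ≡⟨ +-assoc (f zero) _ _ ⟩
  f zero + (sum (λ z → ne (suc a) (suc z) * f (suc z)) + f (suc a))
    ≡⟨ cong (λ s → f zero + (s + f (suc a))) (sum-cong-≗ λ z → cong (_* f (suc z)) (ne-suc a z)) ⟩
  f zero + (sum (λ z → ne a z * f (suc z)) + f (suc a))
    ≡⟨ cong (f zero +_) (sum-ne a (f ∘ suc)) ⟩
  sum f ∎
  where open ≡-Reasoning

Colouring : ℕ → ℕ → Set
Colouring n x = Vec (Fin x) n

-- Summation by overwriting entries: `c` supplies the colours outside `vs`, so sums with a part of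
-- the graph already coloured and sums over all colourings are one notion. In the latter case `c` is
-- an arbitrary starting point.
sumL : List (Fin n) → (Colouring n x → ℕ) → Colouring n x → ℕ
sumL []       F c = F c
sumL (v ∷ vs) F c = sum λ z → sumL vs F (c [ v ]≔ z)

AgreeOff : List (Fin n) → Colouring n x → Colouring n x → Set
AgreeOff vs c d = ∀ v → v ∉ vs → lookup d v ≡ lookup c v

agreeOff-∷ : ∀ {v} {vs : List (Fin n)} (c : Colouring n x) {d} z →
  AgreeOff vs (c [ v ]≔ z) d → AgreeOff (v ∷ vs) c d
agreeOff-∷ c z agr w w∉ =
  trans (agr w (w∉ ∘ there)) (lookup∘update′ (w∉ ∘ here) c z)

-- The comparison may use `AgreeOff`: this is how the colours of the ends of an ear stay known while
-- its inner vertices are summed out.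
sumL-mono : ∀ (vs : List (Fin n)) {F H : Colouring n x → ℕ} c →
  (∀ d → AgreeOff vs c d → F d ≤ H d) → sumL vs F c ≤ sumL vs H c
sumL-mono []       c F≤H = F≤H c λ _ _ → refl
sumL-mono (v ∷ vs) c F≤H =
  sum-mono λ z → sumL-mono vs (c [ v ]≔ z) λ d agr → F≤H d (agreeOff-∷ c {d} z agr)

sumL-cong : ∀ (vs : List (Fin n)) {F H : Colouring n x → ℕ} c →
  (∀ d → AgreeOff vs c d → F d ≡ H d) → sumL vs F c ≡ sumL vs H c
sumL-cong vs c F≡H = ≤-antisym (sumL-mono vs c λ d agr → ≤-reflexive (F≡H d agr))
                               (sumL-mono vs c λ d agr → ≤-reflexive (≡.sym (F≡H d agr)))

sumL-++ : ∀ (us vs : List (Fin n)) (F : Colouring n x → ℕ) c →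
  sumL (us ++ vs) F c ≡ sumL us (sumL vs F) c
sumL-++ []       vs F c = refl
sumL-++ (u ∷ us) vs F c = sum-cong-≗ λ z → sumL-++ us vs F (c [ u ]≔ z)

sumL-+ : ∀ (vs : List (Fin n)) (F H : Colouring n x → ℕ) c →
  sumL vs (λ d → F d + H d) c ≡ sumL vs F c + sumL vs H c
sumL-+ []       F H c = refl
sumL-+ (v ∷ vs) F H c = trans (sum-cong-≗ λ z → sumL-+ vs F H (c [ v ]≔ z)) (∑-distrib-+ (λ z → sumL vs F (c [ v ]≔ z)) _)

sumL-*ˡ : ∀ (vs : List (Fin n)) a (F : Colouring n x → ℕ) c →
  sumL vs (λ d → a * F d) c ≡ a * sumL vs F c
sumL-*ˡ []       a F c = refl
sumL-*ˡ (v ∷ vs) a F c = trans (sum-cong-≗ λ z → sumL-*ˡ vs a F (c [ v ]≔ z)) (sum-*ˡ a (λ z → sumL vs F (c [ v ]≔ z)))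

sumL-*ʳ : ∀ (vs : List (Fin n)) a (F : Colouring n x → ℕ) c →
  sumL vs (λ d → F d * a) c ≡ sumL vs F c * a
sumL-*ʳ vs a F c = trans (sumL-cong vs c λ d _ → *-comm (F d) a)
  (trans (sumL-*ˡ vs a F c) (*-comm a _))

sumL-swap : ∀ (u v : Fin n) (F : Colouring n x → ℕ) c →
  sumL (u ∷ v ∷ []) F c ≡ sumL (v ∷ u ∷ []) F c
sumL-swap u v F c with u Fin.≟ v
... | yes refl = refl
... | no u≢v = trans (∑-comm λ z w → F ((c [ u ]≔ z) [ v ]≔ w))
  (sum-cong-≗ λ w → sum-cong-≗ λ z → cong F ([]≔-commutes {x = z} {y = w} c u v u≢v))

sumL-↭ : ∀ {us vs : List (Fin n)} → us ↭ vs → ∀ (F : Colouring n x → ℕ) c →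
  sumL us F c ≡ sumL vs F c
sumL-↭ Perm.refl F c = refl
sumL-↭ (prep v p) F c = sum-cong-≗ λ z → sumL-↭ p F (c [ v ]≔ z)
sumL-↭ (swap {xs} {ys} u v p) F c =
  trans (sum-cong-≗ λ z → sum-cong-≗ λ w → sumL-↭ p F ((c [ u ]≔ z) [ v ]≔ w))
        (sumL-swap u v (sumL ys F) c)
sumL-↭ (Perm.trans p q) F c = trans (sumL-↭ p F c) (sumL-↭ q F c)

sumOver : ∀ {A : Set} → (A → ℕ) → List A → ℕ
sumOver F cs = ListAction.sum (map F cs)

sumOver-++ : ∀ {A : Set} (F : A → ℕ) as bs → sumOver F (as ++ bs) ≡ sumOver F as + sumOver F bs
sumOver-++ F []       bs = refl
sumOver-++ F (a ∷ as) bs = trans (cong (F a +_) (sumOver-++ F as bs)) (≡.sym (+-assoc (F a) _ _))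

sumOver-tabulate : ∀ {A B : Set} (F : B → ℕ) (g : A → B) (f : Fin x → A) →
  sumOver F (map g (List.tabulate f)) ≡ sum (F ∘ g ∘ f)
sumOver-tabulate {x = zero}  F g f = refl
sumOver-tabulate {x = suc x} F g f = cong (F (g (f zero)) +_) (sumOver-tabulate F g (f ∘ suc))

sumOver-concatMap : ∀ {A B : Set} (F : B → ℕ) (g : A → List B) as →
  sumOver F (concatMap g as) ≡ sumOver (sumOver F ∘ g) as
sumOver-concatMap F g []       = refl
sumOver-concatMap F g (a ∷ as) =
  trans (sumOver-++ F (g a) _) (cong (sumOver F (g a) +_) (sumOver-concatMap F g as))

sumOver-cong : ∀ {A : Set} {F H : A → ℕ} → (∀ a → F a ≡ H a) → ∀ as → sumOver F as ≡ sumOver H as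
sumOver-cong F≡H []       = refl
sumOver-cong F≡H (a ∷ as) = cong₂ _+_ (F≡H a) (sumOver-cong F≡H as)

sumL-map-suc : ∀ vs (F : Colouring (suc n) x → ℕ) a c →
  sumL (map suc vs) F (a ∷ c) ≡ sumL vs (λ d → F (a ∷ d)) c
sumL-map-suc []       F a c = refl
sumL-map-suc (v ∷ vs) F a c = sum-cong-≗ λ z → sumL-map-suc vs F a (c [ v ]≔ z)

allFin-suc : ∀ n → map suc (allFin n) ++ [ zero ] ↭ allFin (suc n)
allFin-suc n = Perm.trans (Perm.++-comm (map suc (allFin n)) [ zero ])
  (Perm.↭-reflexive (cong (zero ∷_) (map-tabulate id suc)))

-- `allColourings` varies the first entry fastest, so `zero` is the innermost vertex of the sum and
-- has to be moved to the front of the list. Every entry of `c` is overwritten.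
sumOver-allColourings : ∀ (F : Colouring n x → ℕ) c →
  sumOver F (allColourings n x) ≡ sumL (allFin n) F c
sumOver-allColourings {zero}  F []      = +-identityʳ (F [])
sumOver-allColourings {suc n} {x} F (a ∷ c) = begin
  sumOver F (allColourings (suc n) x)
    ≡⟨ sumOver-concatMap F _ (allColourings n x) ⟩
  sumOver (λ d → sumOver F (map (_∷ d) (allFin x))) (allColourings n x)
    ≡⟨ sumOver-cong (λ d → sumOver-tabulate F (_∷ d) id) (allColourings n x) ⟩
  sumOver (λ d → sum λ z → F (z ∷ d)) (allColourings n x)
    ≡⟨ sumOver-allColourings (λ d → sum λ z → F (z ∷ d)) c ⟩
  sumL (allFin n) (λ d → sum λ z → F (z ∷ d)) c
    ≡⟨ sumL-map-suc (allFin n) (sumL [ zero ] F) a c ⟨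
  sumL (map suc (allFin n)) (sumL [ zero ] F) (a ∷ c)
    ≡⟨ sumL-++ (map suc (allFin n)) [ zero ] F (a ∷ c) ⟨
  sumL (map suc (allFin n) ++ [ zero ]) F (a ∷ c)
    ≡⟨ sumL-↭ (allFin-suc n) F (a ∷ c) ⟩
  sumL (allFin (suc n)) F (a ∷ c) ∎
  where open ≡-Reasoning

proper : Graph n → Colouring n x → ℕ
proper G c = if does (proper? G c) then 1 else 0

length-filter : ∀ (G : Graph n) (cs : List (Colouring n x)) →
  length (filter (proper? G) cs) ≡ sumOver (proper G) cs
length-filter G [] = refl
length-filter G (c ∷ cs) with does (proper? G c)
... | true  = cong suc (length-filter G cs)
... | false = length-filter G cs

P≡sumL : ∀ (G : Graph n) {vs} → vs ↭ allFin n → (c : Colouring n x) →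
  P G x ≡ sumL vs (proper G) c
P≡sumL {n} {x} G vs↭ c = trans (length-filter G (allColourings n x))
  (trans (sumOver-allColourings (proper G) c) (sumL-↭ (Perm.↭-sym vs↭) (proper G) c))

-- Colourings of a path with prescribed end colours

-- The number of colours is 4 + y, so that no subtraction occurs in the recursion.
E D : ℕ → ℕ → ℕ
E y zero    = 0
E y (suc l) = (3 + y) * D y l
D y zero    = 1
D y (suc l) = E y l + (2 + y) * D y l

N : ∀ y → ℕ → Fin (4 + y) → Fin (4 + y) → ℕ
N y l α β with α Fin.≟ β
... | yes _ = E y l
... | no _  = D y l

N-refl : ∀ l (α : Fin (4 + y)) → N y l α α ≡ E y l
N-refl l α with α Fin.≟ α
... | yes _  = refl
... | no α≢α = ⊥-elim (α≢α refl)

N-≢ : ∀ l {α β : Fin (4 + y)} → α ≢ β → N y l α β ≡ D y l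
N-≢ l {α} {β} α≢β with α Fin.≟ β
... | yes α≡β = ⊥-elim (α≢β α≡β)
... | no _    = refl

N-zero : ∀ (α β : Fin (4 + y)) → N y 0 α β ≡ ne α β
N-zero α β with α Fin.≟ β
... | yes _ = refl
... | no _  = refl

sum-N : ∀ l (β : Fin (4 + y)) → sum (λ z → N y l z β) ≡ E y l + (3 + y) * D y l
sum-N {y} l β = begin
  sum (λ z → N y l z β)                            ≡⟨ sum-ne β (λ z → N y l z β) ⟨
  sum (λ z → ne β z * N y l z β) + N y l β β       ≡⟨ cong₂ _+_ (sum-cong-≗ only-D) (N-refl l β) ⟩
  sum (λ z → ne β z * D y l) + E y l               ≡⟨ cong (_+ E y l) sum-D ⟩
  (3 + y) * D y l + E y l                          ≡⟨ +-comm _ (E y l) ⟩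
  E y l + (3 + y) * D y l                          ∎
  where
  open ≡-Reasoning
  only-D : ∀ z → ne β z * N y l z β ≡ ne β z * D y l
  only-D z with β Fin.≟ z
  ... | yes _  = refl
  ... | no β≢z = cong (1 *_) (N-≢ l (β≢z ∘ ≡.sym))
  sum-D : sum (λ z → ne β z * D y l) ≡ (3 + y) * D y l
  sum-D = +-cancelʳ-≡ (D y l) _ _ (trans (sum-ne β (λ _ → D y l))
    (trans (sum-const {4 + y} (D y l)) (+-comm (D y l) _)))

-- The transfer step: `z` is the colour of the first inner vertex. Adding the forbidden term `z = α`
-- to both sides gives the full sum `sum-N`, so nothing has to be subtracted.
N-step : ∀ l (α β : Fin (4 + y)) → sum (λ z → ne α z * N y l z β) ≡ N y (suc l) α β
N-step {y} l α β = +-cancelʳ-≡ (N y l α β) _ _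
  (trans (sum-ne α (λ z → N y l z β)) (trans (sum-N l β) total))
  where
  total : E y l + (3 + y) * D y l ≡ N y (suc l) α β + N y l α β
  total with α Fin.≟ β
  ... | yes _ = +-comm (E y l) _
  ... | no _  = solve 3 (λ e d t → e :+ (d :+ t) := e :+ t :+ d) refl (E y l) (D y l) ((2 + y) * D y l)
    where open +-*-Solver

path : Fin x → List (Fin n) → Fin x → Colouring n x → ℕ
path α []       β c = ne α β
path α (p ∷ ps) β c = ne α (lookup c p) * path (lookup c p) ps β c

-- The extra weight `g` is the constant 1 for plain counting, or the indicator that two given
-- vertices receive different or equal colours.
pathSum : (Colouring n x → ℕ) → Fin x → List (Fin n) → Fin x → Colouring n x → ℕ
pathSum g α ps β = sumL ps λ d → path α ps β d * g d

module _ (g : Colouring n x → ℕ) {p : Fin n} {ps : List (Fin n)} (p∉ps : p ∉ ps) (α β : Fin x) where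

  pathSum-∷ : ∀ c → pathSum g α (p ∷ ps) β c ≡ sum λ z → ne α z * pathSum g z ps β (c [ p ]≔ z)
  pathSum-∷ c = sum-cong-≗ λ z →
    trans (sumL-cong ps (c [ p ]≔ z) λ d agr →
             trans (cong (λ w → ne α w * path w ps β d * g d) (trans (agr p p∉ps) (lookup∘update p c z)))
                   (*-assoc (ne α z) (path z ps β d) (g d)))
          (sumL-*ˡ ps (ne α z) (λ d → path z ps β d * g d) (c [ p ]≔ z))

  private
    term : ∀ c {z} → α ≢ z → ne α z * pathSum g z ps β (c [ p ]≔ z) ≡ pathSum g z ps β (c [ p ]≔ z)
    term c {z} α≢z = trans (cong (_* pathSum g z ps β (c [ p ]≔ z)) (ne-≢ α≢z)) (*-identityˡ _)

  pathSum-≥ : ∀ c {z} → α ≢ z → pathSum g z ps β (c [ p ]≔ z) ≤ pathSum g α (p ∷ ps) β c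
  pathSum-≥ c {z} α≢z = begin
    pathSum g z ps β (c [ p ]≔ z)                             ≡⟨ term c α≢z ⟨
    ne α z * pathSum g z ps β (c [ p ]≔ z)                    ≤⟨ term≤sum (λ z → ne α z * pathSum g z ps β (c [ p ]≔ z)) z ⟩
    (sum λ z → ne α z * pathSum g z ps β (c [ p ]≔ z))        ≡⟨ pathSum-∷ c ⟨
    pathSum g α (p ∷ ps) β c                                  ∎
    where open ≤-Reasoning

  pathSum-≥₂ : ∀ c {z w} → z ≢ w → α ≢ z → α ≢ w →
    pathSum g z ps β (c [ p ]≔ z) + pathSum g w ps β (c [ p ]≔ w) ≤ pathSum g α (p ∷ ps) β c
  pathSum-≥₂ c {z} {w} z≢w α≢z α≢w = begin
    pathSum g z ps β (c [ p ]≔ z) + pathSum g w ps β (c [ p ]≔ w)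
      ≡⟨ cong₂ _+_ (term c α≢z) (term c α≢w) ⟨
    ne α z * pathSum g z ps β (c [ p ]≔ z) + ne α w * pathSum g w ps β (c [ p ]≔ w)
      ≤⟨ terms≤sum (λ z → ne α z * pathSum g z ps β (c [ p ]≔ z)) z≢w ⟩
    (sum λ z → ne α z * pathSum g z ps β (c [ p ]≔ z))
      ≡⟨ pathSum-∷ c ⟨
    pathSum g α (p ∷ ps) β c ∎
    where open ≤-Reasoning

pathSum-1 : ∀ {ps : List (Fin n)} → Unique ps → ∀ (α β : Fin (4 + y)) c →
  pathSum (λ _ → 1) α ps β c ≡ N y (length ps) α β
pathSum-1 {ps = []}     _ α β c = trans (*-identityʳ _) (≡.sym (N-zero α β))
pathSum-1 {ps = p ∷ ps} u@(_ ∷ us) α β c = trans (pathSum-∷ (λ _ → 1) (head∉ u) α β c)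
  (trans (sum-cong-≗ λ z → cong (ne α z *_) (pathSum-1 us z β (c [ p ]≔ z))) (N-step (length ps) α β))

sumL-path : ∀ {ps : List (Fin n)} → Unique ps → ∀ (α β : Fin (4 + y)) c →
  sumL ps (path α ps β) c ≡ N y (length ps) α β
sumL-path {ps = ps} us α β c =
  trans (sumL-cong ps c λ d _ → ≡.sym (*-identityʳ (path α ps β d))) (pathSum-1 us α β c)

-- Greedy colourings of a path that separate or identify two given vertices

private
  -- The index of `b` after deletion of `a`. The value `zero` for `b = a` is harmless, because
  -- `punchIn a` never hits `a`.
  lower : ∀ {m} → Fin (2 + m) → Fin (2 + m) → Fin (suc m)
  lower a b with a Fin.≟ b
  ... | yes _  = zero
  ... | no a≢b = Fin.punchOut a≢b

  punchIn-lower : ∀ {m} (a b : Fin (2 + m)) {w} → w ≢ lower a b → Fin.punchIn a w ≢ b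
  punchIn-lower a b w≢ eq with a Fin.≟ b
  ... | yes refl = Fin.punchInᵢ≢i a _ eq
  ... | no a≢b   = w≢ (Fin.punchIn-injective a _ _ (trans eq (≡.sym (Fin.punchIn-punchOut a≢b))))

-- The forbidden colours are deleted one after the other, and a fourth colour is left over. The
-- assumption `4 ≤ k` enters here, through `4 ≤ x`.
fresh : ∀ (a b c : Fin (4 + y)) → ∃ λ z → z ≢ a × z ≢ b × z ≢ c
fresh a b c = Fin.punchIn a z , Fin.punchInᵢ≢i a z ,
    punchIn-lower a b (Fin.punchInᵢ≢i b′ w) ,
    punchIn-lower a c (punchIn-lower b′ (lower a c) (Fin.punchInᵢ≢i _ zero))
  where
  b′ = lower a b
  w = Fin.punchIn (lower b′ (lower a c)) zero
  z = Fin.punchIn b′ w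

module _ {u v : Fin n} (u≢v : u ≢ v) where

  -- The invariant of the greedy colouring: the two colours differ already, or one of the two
  -- vertices is still to be coloured.
  Separable : List (Fin n) → Colouring n x → Set
  Separable ps c = lookup c u ≢ lookup c v ⊎ (u ∈ ps ⊎ v ∈ ps)

  -- The colour to be avoided at `p` so that `u` and `v` end up different. It matters only when `p`
  -- is `u` or `v`; at other vertices avoiding it does no harm.
  rival : Fin n → Colouring n x → Fin x
  rival p c with p Fin.≟ u
  ... | yes _ = lookup c v
  ... | no _  = lookup c u

  separable-step : ∀ {p ps} (c : Colouring n x) {z} → z ≢ rival p c →
    Separable (p ∷ ps) c → Separable ps (c [ p ]≔ z)
  separable-step {p = p} c {z} z≢ s with p Fin.≟ u
  ... | yes refl = inj₁ λ e → z≢ (trans (≡.sym (lookup∘update u c z))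
          (trans e (lookup∘update′ (u≢v ∘ ≡.sym) c z)))
  ... | no p≢u with p Fin.≟ v
  ...   | yes refl = inj₁ λ e → z≢ (trans (≡.sym (lookup∘update v c z))
          (trans (≡.sym e) (lookup∘update′ u≢v c z)))
  ...   | no p≢v with s
  ...     | inj₁ ≢ = inj₁ λ e → ≢ (trans (≡.sym (lookup∘update′ (p≢u ∘ ≡.sym) c z))
              (trans e (lookup∘update′ (p≢v ∘ ≡.sym) c z)))
  ...     | inj₂ (inj₁ (here e)) = ⊥-elim (p≢u (≡.sym e))
  ...     | inj₂ (inj₁ (there i)) = inj₂ (inj₁ i)
  ...     | inj₂ (inj₂ (here e)) = ⊥-elim (p≢v (≡.sym e))
  ...     | inj₂ (inj₂ (there i)) = inj₂ (inj₂ i)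

  differ : Colouring n x → ℕ
  differ d = ne (lookup d u) (lookup d v)

  mutual
    -- Each vertex takes a colour other than its predecessor's, its rival's and `β`. Avoiding `β`
    -- restores `α ≢ β` for the remaining path, which is what the empty path needs; hence the primed
    -- version for nonempty paths can start from arbitrary end colours.
    pathSum-differ≥1 : ∀ ps {α β : Fin (4 + y)} {c} → α ≢ β → Unique ps → Separable ps c →
      1 ≤ pathSum differ α ps β c
    pathSum-differ≥1 [] α≢β _ (inj₁ ≢) = ≤-reflexive (≡.sym (cong₂ _*_ (ne-≢ α≢β) (ne-≢ ≢)))
    pathSum-differ≥1 [] α≢β _ (inj₂ (inj₁ ()))
    pathSum-differ≥1 [] α≢β _ (inj₂ (inj₂ ()))
    pathSum-differ≥1 (p ∷ ps) {α} {β} _ us s = pathSum-differ≥1′ p ps {α} {β} us s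

    pathSum-differ≥1′ : ∀ p ps {α β : Fin (4 + y)} {c} → Unique (p ∷ ps) → Separable (p ∷ ps) c →
      1 ≤ pathSum differ α (p ∷ ps) β c
    pathSum-differ≥1′ p ps {α} {β} {c} us@(_ ∷ us′) s with z , z≢α , z≢β , z≢ ← fresh α β (rival p c) =
      ≤-trans (pathSum-differ≥1 ps z≢β us′ (separable-step c z≢ s))
              (pathSum-≥ differ (head∉ us) α β c (z≢α ∘ ≡.sym))

  -- As `q` follows, `p` may take the colour `β`. It only has to avoid `α` and its rival, which
  -- leaves two of four colours, and each choice extends along the rest.
  pathSum-differ≥2 : ∀ p q ps {α β : Fin (4 + y)} {c} → Unique (p ∷ q ∷ ps) →
    Separable (p ∷ q ∷ ps) c → 2 ≤ pathSum differ α (p ∷ q ∷ ps) β c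
  pathSum-differ≥2 p q ps {α} {β} {c} us@(_ ∷ us′) s
    with z , z≢α , z≢ , _ ← fresh α (rival p c) α
    with w , w≢α , w≢ , w≢z ← fresh α (rival p c) z =
      ≤-trans (+-mono-≤ (pathSum-differ≥1′ q ps {z} {β} us′ (separable-step c z≢ s))
                        (pathSum-differ≥1′ q ps {w} {β} us′ (separable-step c w≢ s)))
              (pathSum-≥₂ differ (head∉ us) α β c (w≢z ∘ ≡.sym) (z≢α ∘ ≡.sym) (w≢α ∘ ≡.sym))

Chain : (Fin n → Fin n → Set) → Fin n → List (Fin n) → Fin n → Set
Chain R u []       v = R u v
Chain R u (p ∷ ps) v = R u p × Chain R p ps v

agree : Fin n → Fin n → Colouring n x → ℕ
agree u v d = eq (lookup d u) (lookup d v)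

agree-sym : ∀ (u v : Fin n) (d : Colouring n x) → agree u v d ≡ agree v u d
agree-sym u v d with lookup d u Fin.≟ lookup d v | lookup d v Fin.≟ lookup d u
... | yes _ | yes _ = refl
... | no _  | no _  = refl
... | yes e | no ¬e = ⊥-elim (¬e (≡.sym e))
... | no ¬e | yes e = ⊥-elim (¬e (≡.sym e))

mutual
  pathSum-agree≥1 : ∀ {u v} (ps : List (Fin n)) {α β : Fin (4 + y)} {c} → α ≢ β → Unique ps →
    u ∉ ps → v ∉ ps → lookup c u ≡ lookup c v → 1 ≤ pathSum (agree u v) α ps β c
  pathSum-agree≥1 {v = v} [] {c = c} α≢β _ _ _ e = ≤-reflexive (≡.sym (cong₂ _*_ (ne-≢ α≢β)
    (trans (cong (λ a → eq a (lookup c v)) e) (eq-refl (lookup c v)))))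
  pathSum-agree≥1 (p ∷ ps) {α} {β} _ us u∉ v∉ e = pathSum-agree≥1′ p ps {α} {β} us u∉ v∉ e

  pathSum-agree≥1′ : ∀ {u v} p (ps : List (Fin n)) {α β : Fin (4 + y)} {c} → Unique (p ∷ ps) →
    u ∉ p ∷ ps → v ∉ p ∷ ps → lookup c u ≡ lookup c v → 1 ≤ pathSum (agree u v) α (p ∷ ps) β c
  pathSum-agree≥1′ {u = u} {v} p ps {α} {β} {c} us@(_ ∷ us′) u∉ v∉ e
    with z , z≢α , z≢β , _ ← fresh α β β =
      ≤-trans (pathSum-agree≥1 ps z≢β us′ (u∉ ∘ there) (v∉ ∘ there)
                (trans (lookup∘update′ (u∉ ∘ here) c z)
                       (trans e (≡.sym (lookup∘update′ (v∉ ∘ here) c z)))))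
              (pathSum-≥ (agree u v) (head∉ us) α β c (z≢α ∘ ≡.sym))

-- R is the adjacency of G_{n,k}: a chord joins two vertices that R does not relate, so they are
-- not consecutive on the path and can be given the same colour.
module _ {R : Fin n → Fin n → Set} {u v : Fin n} (¬uv : ¬ R u v) (¬vu : ¬ R v u) where

  -- The vertices before `v` avoid the colour of `u`, and `v` then takes it. This can clash with the
  -- predecessor or with the end `β` only if `u` itself is that neighbour of `v`, by the last two
  -- hypotheses, and then `R` would relate `u` and `v`.
  pathSum-agree-inner : ∀ ps {q w} {α β : Fin (4 + y)} {c} → Unique ps → u ∉ ps → v ∈ ps →
    Chain R q ps w → (lookup c u ≡ α → u ≡ q) → (lookup c u ≡ β → u ≡ w) →
    1 ≤ pathSum (agree u v) α ps β c
  pathSum-agree-inner (p ∷ ps) {q} {w} {α} {β} {c} us@(_ ∷ us′) u∉ v∈ (qp , ch) atα atβ with p Fin.≟ v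
  ... | yes refl = ≤-trans (finish ps us′ (u∉ ∘ there) (head∉ us) ch)
                           (pathSum-≥ (agree u v) (head∉ us) α β c α≢)
    where
    γ = lookup c u
    α≢ : α ≢ γ
    α≢ e = ¬uv (subst (λ s → R s v) (≡.sym (atα (≡.sym e))) qp)
    same : lookup (c [ v ]≔ γ) u ≡ lookup (c [ v ]≔ γ) v
    same = trans (lookup∘update′ (u∉ ∘ here) c γ) (≡.sym (lookup∘update v c γ))
    finish : ∀ ps → Unique ps → u ∉ ps → v ∉ ps → Chain R v ps w →
      1 ≤ pathSum (agree u v) γ ps β (c [ v ]≔ γ)
    finish [] us u∉ v∉ vw = pathSum-agree≥1 [] {c = c [ v ]≔ γ} (λ e → ¬vu (subst (R v) (≡.sym (atβ e)) vw)) us u∉ v∉ same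
    finish (p ∷ ps) us u∉ v∉ _ = pathSum-agree≥1′ p ps {γ} {β} us u∉ v∉ same
  ... | no p≢v with z , z≢α , z≢β , z≢γ ← fresh α β (lookup c u) =
      ≤-trans (pathSum-agree-inner ps us′ (u∉ ∘ there) (tail∈ v∈) ch
                 (λ e → ⊥-elim (z≢γ (trans (≡.sym e) unchanged)))
                 (λ e → atβ (trans (≡.sym unchanged) e)))
              (pathSum-≥ (agree u v) (head∉ us) α β c (z≢α ∘ ≡.sym))
    where
    unchanged : ∀ {z} → lookup (c [ p ]≔ z) u ≡ lookup c u
    unchanged {z} = lookup∘update′ (u∉ ∘ here) c z
    tail∈ : v ∈ p ∷ ps → v ∈ ps
    tail∈ (here e)  = ⊥-elim (p≢v (≡.sym e))
    tail∈ (there i) = i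

-- Whichever of the two vertices comes first on the path gets a colour other than `β`. It then acts
-- both as the vertex already coloured and as the left end of the remaining path, which reduces the
-- claim to `pathSum-agree-inner`.
pathSum-agree-inner₂ : ∀ {R : Fin n → Fin n → Set} {u v : Fin n} → u ≢ v → ¬ R u v → ¬ R v u →
  ∀ ps {q w} {α β : Fin (4 + y)} {c} → Unique ps → u ∈ ps → v ∈ ps →
  Chain R q ps w → 1 ≤ pathSum (agree u v) α ps β c
pathSum-agree-inner₂ {u = u} {v} u≢v ¬uv ¬vu (p ∷ ps) {α = α} {β} {c} us@(_ ∷ us′) u∈ v∈ (_ , ch)
  with z , z≢α , z≢β , _ ← fresh α β β with u∈ | v∈
... | here refl | here v≡u = ⊥-elim (u≢v (≡.sym v≡u))
... | here refl | there v∈′ = ≤-trans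
  (pathSum-agree-inner ¬uv ¬vu ps us′ (head∉ us) v∈′ ch (λ _ → refl)
    (λ e → ⊥-elim (z≢β (trans (≡.sym (lookup∘update u c z)) e))))
  (pathSum-≥ (agree u v) (head∉ us) α β c (z≢α ∘ ≡.sym))
... | there u∈′ | here refl = ≤-trans
  (≤-trans
    (pathSum-agree-inner ¬vu ¬uv ps us′ (head∉ us) u∈′ ch (λ _ → refl)
      (λ e → ⊥-elim (z≢β (trans (≡.sym (lookup∘update v c z)) e))))
    (sumL-mono ps (c [ p ]≔ z) λ d _ → ≤-reflexive (cong (path z ps β d *_) (agree-sym v u d))))
  (pathSum-≥ (agree u v) (head∉ us) α β c (z≢α ∘ ≡.sym))
... | there u∈′ | there v∈′ = ≤-trans
  (pathSum-agree-inner₂ u≢v ¬uv ¬vu ps us′ u∈′ v∈′ ch)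
  (pathSum-≥ (agree u v) (head∉ us) α β c (z≢α ∘ ≡.sym))

-- Arithmetic of the path counts

-- Split at the inner vertex number `m + 1`. If it has the colour of the far end, the two pieces
-- give `D y m * E y l`. Otherwise the second piece gives `D y l`, and the first, continued by one
-- step to the far end, gives `D y (suc m)`.
D-+ : ∀ y m l → D y (suc m + l) ≡ D y (suc m) * D y l + D y m * E y l
D-+ y m zero = trans (cong (D y) (+-identityʳ (suc m)))
  (solve 2 (λ a b → a := a :* con 1 :+ b :* con 0) refl (D y (suc m)) (D y m))
  where open +-*-Solver
D-+ y m (suc l) = begin
  D y (suc m + suc l)                                 ≡⟨ cong (D y) (+-suc (suc m) l) ⟩
  D y (suc (suc m) + l)                               ≡⟨ D-+ y (suc m) l ⟩
  D y (suc (suc m)) * D y l + D y (suc m) * E y l     ≡⟨ solve 5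
      (λ w a b d e → ((con 3 :+ w) :* a :+ (con 2 :+ w) :* b) :* d :+ b :* e :=
                     b :* (e :+ (con 2 :+ w) :* d) :+ a :* ((con 3 :+ w) :* d))
      refl y (D y m) (D y (suc m)) (D y l) (E y l) ⟩
  D y (suc m) * D y (suc l) + D y m * E y (suc l)     ∎
  where
  open ≡-Reasoning
  open +-*-Solver

mutual
  -- At `suc l` both counts contain `(2 + y) * D y l`; what remains is `D y l` for `E` and `E y l`
  -- for `D`. So the difference merely changes its sign at each step.
  E≤1+D : ∀ y l → E y l ≤ suc (D y l)
  E≤1+D y zero    = z≤n
  E≤1+D y (suc l) = +-monoˡ-≤ ((2 + y) * D y l) (D≤1+E y l)

  D≤1+E : ∀ y l → D y l ≤ suc (E y l)
  D≤1+E y zero    = ≤-refl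
  D≤1+E y (suc l) = +-monoˡ-≤ ((2 + y) * D y l) (E≤1+D y l)

D≥1 : ∀ y l → 1 ≤ D y l
D≥1 y zero    = ≤-refl
D≥1 y (suc l) = ≤-trans (D≥1 y l) (≤-trans (m≤m+n _ _) (m≤n+m _ (E y l)))

D≥2 : ∀ y l → 2 ≤ D y (suc l)
D≥2 y l = ≤-trans (+-mono-≤ (D≥1 y l) (≤-trans (D≥1 y l) (m≤m+n _ _))) (m≤n+m _ (E y l))

D-suc≤ : ∀ y m → D y (suc m) ≤ suc ((3 + y) * D y m)
D-suc≤ y m = +-monoˡ-≤ ((2 + y) * D y m) (E≤1+D y m)

N≤1+D : ∀ l (α β : Fin (4 + y)) → N y l α β ≤ suc (D y l)
N≤1+D {y} l α β with α Fin.≟ β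
... | yes _ = E≤1+D y l
... | no _  = n≤1+n _

-- The single inner vertex has `x - 1` or `x - 2` colours. Adding the indicator of different ends
-- makes the count constant, so that it can be taken out of the sum over the first ear.
N-1 : ∀ (α β : Fin (4 + y)) → N y 1 α β + ne α β ≡ 3 + y
N-1 {y} α β with α Fin.≟ β
... | yes _ = solve 1 (λ w → (con 3 :+ w) :* con 1 :+ con 0 := con 3 :+ w) refl y
  where open +-*-Solver
... | no _  = solve 1 (λ w → (con 2 :+ w) :* con 1 :+ con 1 := con 3 :+ w) refl y
  where open +-*-Solver

-- By `D-+` it suffices that `D y m * E y (2 + l)` exceeds `D y (suc m)`. Two inner vertices give
-- `E y (2 + l)` the factor `D y (suc l) ≥ 2`, hence about twice the amount required.
second-long-ear : ∀ y m l → D y (suc m) * suc (D y (2 + l)) < D y (suc m + (2 + l))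
second-long-ear y m l = begin
  suc (D y (suc m) * suc (D y (2 + l)))                      ≡⟨ cong suc (*-suc (D y (suc m)) _) ⟩
  suc (D y (suc m)) + D y (suc m) * D y (2 + l)              ≤⟨ +-monoˡ-≤ _ claim ⟩
  D y m * E y (2 + l) + D y (suc m) * D y (2 + l)            ≡⟨ +-comm (D y m * E y (2 + l)) _ ⟩
  D y (suc m) * D y (2 + l) + D y m * E y (2 + l)            ≡⟨ D-+ y m (2 + l) ⟨
  D y (suc m + (2 + l))                                      ∎
  where
  open ≤-Reasoning
  open +-*-Solver
  a = (3 + y) * D y m
  a≥2 : 2 ≤ a
  a≥2 = *-mono-≤ {2} {3 + y} (s≤s (s≤s z≤n)) (D≥1 y m)
  claim : suc (D y (suc m)) ≤ D y m * E y (2 + l)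
  claim = begin
    suc (D y (suc m))                       ≤⟨ s≤s (D-suc≤ y m) ⟩
    2 + a                                   ≤⟨ +-monoˡ-≤ a a≥2 ⟩
    a + a                                   ≡⟨ solve 1 (λ s → s :+ s := s :* con 2) refl a ⟩
    a * 2                                   ≤⟨ *-monoʳ-≤ a (D≥2 y l) ⟩
    a * D y (suc l)                         ≡⟨ solve 3 (λ s d e → s :* d :* e := d :* (s :* e)) refl (3 + y) (D y m) (D y (suc l)) ⟩
    D y m * E y (2 + l)                     ∎

-- The strict hypothesis frees one copy of `D y (suc l)`, since `suc s` times it is still allowed.
-- That copy is at least 1 and covers the unit by which `D y (suc m)` may exceed `(3 + y) * D y m`.
later-ear : ∀ y m l s → s < D y (suc m) → s * suc (D y (suc l)) < D y (suc m + suc l)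
later-ear y m l s s<D = begin
  suc (s * suc (D y (suc l)))                               ≡⟨ cong suc (*-suc s _) ⟩
  suc s + s * D y (suc l)                                   ≤⟨ +-monoˡ-≤ _ s<D ⟩
  D y (suc m) + s * D y (suc l)                             ≤⟨ +-monoˡ-≤ _ (D-suc≤ y m) ⟩
  1 + (3 + y) * D y m + s * D y (suc l)                     ≤⟨ +-monoˡ-≤ _ (+-mono-≤ (D≥1 y (suc l)) grow) ⟩
  D y (suc l) + D y m * E y (suc l) + s * D y (suc l)       ≡⟨ solve 3 (λ d b c → d :+ b :+ c := d :+ c :+ b) refl (D y (suc l)) (D y m * E y (suc l)) (s * D y (suc l)) ⟩
  suc s * D y (suc l) + D y m * E y (suc l)                 ≤⟨ +-monoˡ-≤ _ (*-monoˡ-≤ (D y (suc l)) s<D) ⟩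
  D y (suc m) * D y (suc l) + D y m * E y (suc l)           ≡⟨ D-+ y m (suc l) ⟨
  D y (suc m + suc l)                                       ∎
  where
  open ≤-Reasoning
  open +-*-Solver
  grow : (3 + y) * D y m ≤ D y m * E y (suc l)
  grow = begin
    (3 + y) * D y m                     ≡⟨ *-comm (3 + y) (D y m) ⟩
    D y m * (3 + y)                     ≡⟨ cong (D y m *_) (*-identityʳ (3 + y)) ⟨
    D y m * ((3 + y) * 1)               ≤⟨ *-monoʳ-≤ (D y m) (*-monoʳ-≤ (3 + y) (D≥1 y l)) ⟩
    D y m * E y (suc l)                 ∎

-- The one case in which D y m * (the largest count of the new ear) exceeds D y (m + 1):
-- there the colourings giving the two ends different colours have to be discounted.
second-short-ear : ∀ y m f T → (m ≡ 0 ⊎ 2 ≤ T) → f + T ≡ D y (suc m) * (3 + y) → f < D y (2 + m)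
second-short-ear y .0 f T (inj₁ refl) e = begin
  suc f                          ≤⟨ s≤s (m≤m+n f T) ⟩
  suc (f + T)                    ≡⟨ cong suc e ⟩
  suc (D y 1 * (3 + y))          ≡⟨ solve 1 (λ w → con 1 :+ ((con 2 :+ w) :* con 1) :* (con 3 :+ w) :=
                                       (con 3 :+ w) :* con 1 :+ (con 2 :+ w) :* ((con 2 :+ w) :* con 1)) refl y ⟩
  D y 2                          ∎
  where
  open ≤-Reasoning
  open +-*-Solver
second-short-ear y m f T (inj₂ T≥2) e = +-cancelʳ-≤ 1 _ _ (begin
  suc f + 1                                           ≡⟨ solve 1 (λ f → con 1 :+ f :+ con 1 := f :+ con 2) refl f ⟩
  f + 2                                               ≤⟨ +-monoʳ-≤ f T≥2 ⟩
  f + T                                               ≡⟨ e ⟩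
  D y (suc m) * (3 + y)                               ≡⟨ solve 2 (λ w d → d :* (con 3 :+ w) := d :+ (con 2 :+ w) :* d) refl y (D y (suc m)) ⟩
  D y (suc m) + (2 + y) * D y (suc m)                 ≤⟨ +-monoˡ-≤ _ (D-suc≤ y m) ⟩
  suc (E y (suc m)) + (2 + y) * D y (suc m)           ≡⟨ +-comm 1 (D y (2 + m)) ⟩
  D y (2 + m) + 1                                     ∎)
  where
  open ≤-Reasoning
  open +-*-Solver

-- Cliques and ears

nes : Fin x → List (Fin x) → ℕ
nes z []       = 1
nes z (a ∷ as) = ne a z * nes z as

-- An indicator written as a product of factors 0 or 1, so that one colour at a time can be summed
-- out.
rainbow : List (Fin x) → ℕ
rainbow []       = 1
rainbow (a ∷ as) = nes a as * rainbow as

nes-∉ : ∀ {z : Fin x} as → All (z ≢_) as → nes z as ≡ 1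
nes-∉ []       _            = refl
nes-∉ (a ∷ as) (z≢a ∷ z∉as) = cong₂ _*_ (ne-≢ (z≢a ∘ ≡.sym)) (nes-∉ as z∉as)

nes-01 : ∀ (z : Fin x) as → nes z as ≡ 0 ⊎ (nes z as ≡ 1 × All (z ≢_) as)
nes-01 z [] = inj₂ (refl , [])
nes-01 z (a ∷ as) with a Fin.≟ z
... | yes _ = inj₁ refl
... | no a≢z with nes-01 z as
...   | inj₁ e       = inj₁ (cong (1 *_) e)
...   | inj₂ (e , z∉) = inj₂ (cong (1 *_) e , (a≢z ∘ ≡.sym) ∷ z∉)

rainbow-unique : ∀ {as : List (Fin x)} → Unique as → rainbow as ≡ 1
rainbow-unique []        = refl
rainbow-unique (a∉ ∷ us) = cong₂ _*_ (nes-∉ _ a∉) (rainbow-unique us)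

rainbow-01 : ∀ (as : List (Fin x)) → rainbow as ≡ 0 ⊎ (rainbow as ≡ 1 × Unique as)
rainbow-01 [] = inj₂ (refl , [])
rainbow-01 (a ∷ as) with nes-01 a as | rainbow-01 as
... | inj₁ e        | _             = inj₁ (cong (_* rainbow as) e)
... | inj₂ _        | inj₁ e        = inj₁ (trans (cong (nes a as *_) e) (*-zeroʳ (nes a as)))
... | inj₂ (e , a∉) | inj₂ (e′ , us) = inj₂ (cong₂ _*_ e e′ , a∉ ∷ us)

sum-nes : ∀ {as : List (Fin x)} → Unique as → sum (λ z → nes z as) + length as ≡ x
sum-nes {x} [] = trans (+-identityʳ _) (trans (sum-const {x} 1) (*-identityʳ x))
sum-nes {as = a ∷ as} (a∉ ∷ us) = begin
  sum (λ z → ne a z * nes z as) + suc (length as)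
    ≡⟨ +-suc _ (length as) ⟩
  suc (sum (λ z → ne a z * nes z as)) + length as
    ≡⟨ cong (_+ length as) (+-comm 1 _) ⟩
  sum (λ z → ne a z * nes z as) + 1 + length as
    ≡⟨ cong (λ s → sum (λ z → ne a z * nes z as) + s + length as) (nes-∉ as a∉) ⟨
  sum (λ z → ne a z * nes z as) + nes a as + length as
    ≡⟨ cong (_+ length as) (sum-ne a (λ z → nes z as)) ⟩
  sum (λ z → nes z as) + length as
    ≡⟨ sum-nes us ⟩
  _ ∎
  where open ≡-Reasoning

-- With a repetition in `as` both sides vanish. Without one, `sum-nes` shows that the truncated
-- subtraction is exact.
sum-rainbow : ∀ (as : List (Fin x)) → sum (λ z → rainbow (z ∷ as)) ≡ rainbow as * (x ∸ length as)
sum-rainbow {x} as = trans (sum-cong-≗ λ z → *-comm (nes z as) _)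
  (trans (sum-*ˡ (rainbow as) (λ z → nes z as)) count)
  where
  count : rainbow as * sum (λ z → nes z as) ≡ rainbow as * (x ∸ length as)
  count with rainbow-01 as
  ... | inj₁ e = trans (cong (_* sum (λ z → nes z as)) e) (≡.sym (cong (_* (x ∸ length as)) e))
  ... | inj₂ (_ , us) = cong (rainbow as *_)
    (trans (≡.sym (m+n∸n≡m _ (length as))) (cong (_∸ length as) (sum-nes us)))

-- Peels off the last factor rather than the first: it is the number of colours left for the next
-- clique vertex.
falling-suc : ∀ x m → falling x (suc m) ≡ (x ∸ m) * falling x m
falling-suc x zero    = refl
falling-suc x (suc m) = begin
  x * falling (x ∸ 1) (suc m)                    ≡⟨ cong (x *_) (falling-suc (x ∸ 1) m) ⟩
  x * ((x ∸ 1 ∸ m) * falling (x ∸ 1) m)          ≡⟨ cong (λ s → x * (s * falling (x ∸ 1) m)) (∸-+-assoc x 1 m) ⟩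
  x * ((x ∸ suc m) * falling (x ∸ 1) m)          ≡⟨ solve 3 (λ a b c → a :* (b :* c) := b :* (a :* c)) refl x (x ∸ suc m) (falling (x ∸ 1) m) ⟩
  (x ∸ suc m) * falling x (suc m)                ∎
  where
  open ≡-Reasoning
  open +-*-Solver

falling>0 : ∀ {k x} → k ≤ x → 0 < falling x k
falling>0 z≤n       = s≤s z≤n
falling>0 {suc k} {suc x} (s≤s k≤x) = *-mono-≤ {1} {suc x} (s≤s z≤n) (falling>0 k≤x)

clique : List (Fin n) → Colouring n x → ℕ
clique vs c = rainbow (map (lookup c) vs)

map-lookup-≡ : ∀ (vs : List (Fin n)) (c d : Colouring n x) →
  (∀ v → v ∈ vs → lookup d v ≡ lookup c v) → map (lookup d) vs ≡ map (lookup c) vs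
map-lookup-≡ []       c d h = refl
map-lookup-≡ (v ∷ vs) c d h = cong₂ _∷_ (h v (here refl)) (map-lookup-≡ vs c d λ w w∈ → h w (there w∈))

sumL-clique : ∀ {vs : List (Fin n)} → Unique vs → ∀ (c : Colouring n x) →
  sumL vs (clique vs) c ≡ falling x (length vs)
sumL-clique {vs = []} [] c = refl
sumL-clique {x = x} {vs = v ∷ vs} us@(_ ∷ us′) c = begin
  -- `v` becomes the innermost vertex of the sum, because the number of its free colours is known
  -- once the others are coloured.
  sumL (v ∷ vs) (clique (v ∷ vs)) c                               ≡⟨ sumL-↭ (Perm.∷↭∷ʳ v vs) (clique (v ∷ vs)) c ⟩
  sumL (vs ++ [ v ]) (clique (v ∷ vs)) c                          ≡⟨ sumL-++ vs [ v ] (clique (v ∷ vs)) c ⟩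
  sumL vs (λ d → sum λ z → clique (v ∷ vs) (d [ v ]≔ z)) c        ≡⟨ sumL-cong vs c (λ d _ → inner d) ⟩
  sumL vs (λ d → clique vs d * (x ∸ length vs)) c                 ≡⟨ sumL-*ʳ vs (x ∸ length vs) (clique vs) c ⟩
  sumL vs (clique vs) c * (x ∸ length vs)                         ≡⟨ cong (_* (x ∸ length vs)) (sumL-clique us′ c) ⟩
  falling x (length vs) * (x ∸ length vs)                         ≡⟨ *-comm (falling x (length vs)) _ ⟩
  (x ∸ length vs) * falling x (length vs)                         ≡⟨ falling-suc x (length vs) ⟨
  falling x (suc (length vs))                                     ∎
  where
  open ≡-Reasoning
  inner : ∀ d → sum (λ z → clique (v ∷ vs) (d [ v ]≔ z)) ≡ clique vs d * (x ∸ length vs)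
  inner d = trans
    (sum-cong-≗ λ z → cong rainbow (cong₂ _∷_ (lookup∘update v d z)
      (map-lookup-≡ vs d (d [ v ]≔ z) λ w w∈ → lookup∘update′ (λ { refl → head∉ us w∈ }) d z)))
    (trans (sum-rainbow (map (lookup d) vs)) (cong (λ m → clique vs d * (x ∸ m)) (length-map (lookup d) vs)))

Unique-map⇒injective : ∀ {A B : Set} {f : A → B} {vs} → Unique (map f vs) →
  ∀ {u v} → u ∈ vs → v ∈ vs → f u ≡ f v → u ≡ v
Unique-map⇒injective (_ ∷ us)  (here refl) (here refl) e = refl
Unique-map⇒injective (a∉ ∷ us) (here refl) (there v∈)  e = ⊥-elim (All.lookup a∉ (∈-map⁺ _ v∈) e)
Unique-map⇒injective (a∉ ∷ us) (there u∈)  (here refl) e = ⊥-elim (All.lookup a∉ (∈-map⁺ _ u∈) (≡.sym e))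
Unique-map⇒injective (_ ∷ us)  (there u∈)  (there v∈)  e = Unique-map⇒injective us u∈ v∈ e

Distinct : List (Fin n) → Colouring n x → Set
Distinct ks c = ∀ {u v} → u ∈ ks → v ∈ ks → lookup c u ≡ lookup c v → u ≡ v

clique-01 : ∀ (ks : List (Fin n)) (c : Colouring n x) → clique ks c ≡ 0 ⊎ (clique ks c ≡ 1 × Distinct ks c)
clique-01 ks c with rainbow-01 (map (lookup c) ks)
... | inj₁ e        = inj₁ e
... | inj₂ (e , us) = inj₂ (e , Unique-map⇒injective us)

clique-1 : ∀ {ks : List (Fin n)} {c : Colouring n x} → Unique ks → Distinct ks c → clique ks c ≡ 1
clique-1 {ks = ks} {c} us dist = rainbow-unique (go us dist)
  where
  go : ∀ {ks} → Unique ks → Distinct ks c → Unique (map (lookup c) ks)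
  go []                 _    = []
  go {k ∷ ks} us@(k∉ ∷ us′) dist =
    All.tabulate (λ a∈ e → case ∈-map⁻ (lookup c) a∈ of λ where
      (v , v∈ , refl) → head∉ us (subst (_∈ ks) (≡.sym (dist (here refl) (there v∈) e)) v∈))
    ∷ go us′ (λ u∈ v∈ → dist (there u∈) (there v∈))

clique-local : ∀ (ks : List (Fin n)) {c d : Colouring n x} →
  (∀ v → v ∈ ks → lookup d v ≡ lookup c v) → clique ks d ≡ clique ks c
clique-local ks {c} {d} h = cong rainbow (map-lookup-≡ ks c d h)

path-local : ∀ (ps : List (Fin n)) (α β : Fin x) {c d : Colouring n x} →
  (∀ v → v ∈ ps → lookup d v ≡ lookup c v) → path α ps β d ≡ path α ps β c
path-local []       α β h = refl
path-local (p ∷ ps) α β {c} {d} h = trans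
  (cong (λ z → ne α z * path z ps β d) (h p (here refl)))
  (cong (ne α (lookup c p) *_) (path-local ps (lookup c p) β λ v v∈ → h v (there v∈)))

-- Ears, and the loss caused by a second one

-- `S` holds the vertices reached so far. A single edge between them is no ear: every ear brings in
-- a new vertex, which bounds their number and supplies the positive lengths in the estimates.
record Ear (G : Graph n) (S ps : List (Fin n)) : Set where
  field
    s t      : Fin n
    s∈       : s ∈ S
    t∈       : t ∈ S
    s≢t      : s ≢ t
    chain    : Chain (Adj G) s ps t
    unique   : Unique ps
    disjoint : ∀ {v} → v ∈ ps → v ∉ S
    nonempty : ps ≢ []

data Ears (G : Graph n) (ks : List (Fin n)) : List (Fin n) → Set where
  one  : ∀ {ps} → Ear G ks ps → Ears G ks ps
  more : ∀ {vs ps} → Ears G ks vs → Ear G (ks ++ vs) ps → Ears G ks (vs ++ ps)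

module _ {G : Graph n} where
  open Ear

  earWeight : ∀ {S ps} → Ear G S ps → Colouring n x → ℕ
  earWeight {ps = ps} e c = path (lookup c (s e)) ps (lookup c (t e)) c

  -- Edges of `G` on no ear impose no condition here. Together with `clique` this bounds the
  -- indicator of proper colourings from above.
  weight : ∀ {ks vs} → Ears G ks vs → Colouring n x → ℕ
  weight (one e)     c = earWeight e c
  weight (more es e) c = weight es c * earWeight e c

  earWeight-local : ∀ {S ps} (e : Ear G S ps) {c d : Colouring n x} →
    (∀ v → v ∈ S ++ ps → lookup d v ≡ lookup c v) → earWeight e d ≡ earWeight e c
  earWeight-local {S = S} {ps} e {c} {d} h = trans
    (cong₂ (λ α β → path α ps β d) (h (s e) (∈-++⁺ˡ (s∈ e))) (h (t e) (∈-++⁺ˡ (t∈ e))))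
    (path-local ps _ _ λ v v∈ → h v (∈-++⁺ʳ S v∈))

  weight-local : ∀ {ks vs} (es : Ears G ks vs) {c d : Colouring n x} →
    (∀ v → v ∈ ks ++ vs → lookup d v ≡ lookup c v) → weight es d ≡ weight es c
  weight-local (one e) h = earWeight-local e h
  weight-local {ks = ks} (more {vs} {ps} es e) h = cong₂ _*_
    (weight-local es λ v v∈ → h v (subst (v ∈_) (++-assoc ks vs ps) (∈-++⁺ˡ v∈)))
    (earWeight-local e λ v v∈ → h v (subst (v ∈_) (++-assoc ks vs ps) v∈))

  earWeight-fixed : ∀ {S ps} (e : Ear G S ps) {c d : Colouring n x} → AgreeOff ps c d →
    earWeight e d ≡ path (lookup c (s e)) ps (lookup c (t e)) d
  earWeight-fixed {ps = ps} e {d = d} agr = cong₂ (λ α β → path α ps β d)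
    (agr (s e) λ i → disjoint e i (s∈ e)) (agr (t e) λ i → disjoint e i (t∈ e))

  -- The ends of the ear and all vertices that `F` looks at lie in `S`, away from `ps`, so they are
  -- constant during the summation.
  sumL-ear : ∀ {S ps} (e : Ear G S ps) (F : Colouring n (4 + y) → ℕ) →
    (∀ {c d} → (∀ v → v ∈ S → lookup d v ≡ lookup c v) → F d ≡ F c) → ∀ c →
    sumL ps (λ d → F d * earWeight e d) c ≡ F c * N y (length ps) (lookup c (s e)) (lookup c (t e))
  sumL-ear {ps = ps} e F F-local c = begin
    sumL ps (λ d → F d * earWeight e d) c
      ≡⟨ sumL-cong ps c (λ d agr → cong₂ _*_
           (F-local λ v v∈ → agr v λ i → disjoint e i v∈) (earWeight-fixed e {c = c} {d} agr)) ⟩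
    sumL ps (λ d → F c * path (lookup c (s e)) ps (lookup c (t e)) d) c
      ≡⟨ sumL-*ˡ ps (F c) (path (lookup c (s e)) ps (lookup c (t e))) c ⟩
    F c * sumL ps (path (lookup c (s e)) ps (lookup c (t e))) c
      ≡⟨ cong (F c *_) (sumL-path (unique e) _ _ c) ⟩
    F c * N _ (length ps) (lookup c (s e)) (lookup c (t e)) ∎
    where open ≡-Reasoning

  sumL-first-ear : ∀ {ks ps} (e : Ear G ks ps) {c : Colouring n (4 + y)} → Distinct ks c →
    sumL ps (earWeight e) c ≡ D y (length ps)
  sumL-first-ear {ks = ks} {ps} e {c} dist = begin
    sumL ps (earWeight e) c                                ≡⟨ sumL-cong ps c (λ d _ → ≡.sym (*-identityˡ (earWeight e d))) ⟩
    sumL ps (λ d → 1 * earWeight e d) c                    ≡⟨ sumL-ear e (λ _ → 1) (λ _ → refl) c ⟩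
    1 * N _ (length ps) (lookup c (s e)) (lookup c (t e))  ≡⟨ *-identityˡ _ ⟩
    N _ (length ps) (lookup c (s e)) (lookup c (t e))      ≡⟨ N-≢ (length ps) (s≢t e ∘ dist (s∈ e) (t∈ e)) ⟩
    D _ (length ps)                                        ∎
    where open ≡-Reasoning

  sumL-more : ∀ {ks vs ps} (es : Ears G ks vs) (e : Ear G (ks ++ vs) ps) (c : Colouring n (4 + y)) →
    sumL (vs ++ ps) (weight (more es e)) c ≡
    sumL vs (λ d → weight es d * N y (length ps) (lookup d (s e)) (lookup d (t e))) c
  sumL-more {vs = vs} {ps} es e c = trans (sumL-++ vs ps (weight (more es e)) c)
    (sumL-cong vs c λ d _ → sumL-ear e (weight es) (weight-local es) d)

  -- A crude estimate that treats all colourings of the earlier ears as if the ends had the more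
  -- favourable colours. It suffices unless the second ear has a single inner vertex.
  sumL-more≤ : ∀ {ks vs ps} (es : Ears G ks vs) (e : Ear G (ks ++ vs) ps) (c : Colouring n (4 + y)) →
    sumL (vs ++ ps) (weight (more es e)) c ≤ sumL vs (weight es) c * suc (D y (length ps))
  sumL-more≤ {y} {vs = vs} {ps} es e c = begin
    sumL (vs ++ ps) (weight (more es e)) c
      ≡⟨ sumL-more es e c ⟩
    sumL vs (λ d → weight es d * N y (length ps) (lookup d (s e)) (lookup d (t e))) c
      ≤⟨ sumL-mono vs c (λ d _ → *-monoʳ-≤ (weight es d) (N≤1+D (length ps) (lookup d (s e)) (lookup d (t e)))) ⟩
    sumL vs (λ d → weight es d * suc (D y (length ps))) c
      ≡⟨ sumL-*ʳ vs _ (weight es) c ⟩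
    sumL vs (weight es) c * suc (D y (length ps)) ∎
    where open ≤-Reasoning

  -- Two clique vertices have different colours from the start; otherwise one of `u` and `v` is
  -- still free. A first ear with one inner vertex is set apart because the count can then drop to
  -- `x - 3`, which is 1 for four colours.
  first-ear-differ : ∀ {ks ps} (e : Ear G ks ps) {c : Colouring n (4 + y)} → Distinct ks c →
    ∀ {u v} (u≢v : u ≢ v) → u ∈ ks ++ ps → v ∈ ks ++ ps →
    ∀ {m} → length ps ≡ suc m →
    m ≡ 0 ⊎ 2 ≤ sumL ps (λ d → earWeight e d * differ u≢v d) c
  first-ear-differ {ps = p ∷ []} e dist u≢v u∈ v∈ refl = inj₁ refl
  first-ear-differ {ks = ks} {p ∷ q ∷ ps} e {c} dist {u} {v} u≢v u∈ v∈ _ = inj₂ (begin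
    2                                                                        ≤⟨ pathSum-differ≥2 u≢v p q ps {α} {β} {c} (unique e) sep ⟩
    pathSum (differ u≢v) α (p ∷ q ∷ ps) β c                                  ≡⟨ sumL-cong (p ∷ q ∷ ps) c (λ d agr → cong (_* differ u≢v d) (≡.sym (earWeight-fixed e {c = c} {d} agr))) ⟩
    sumL (p ∷ q ∷ ps) (λ d → earWeight e d * differ u≢v d) c                 ∎)
    where
    open ≤-Reasoning
    α = lookup c (s e)
    β = lookup c (t e)
    sep : Separable u≢v (p ∷ q ∷ ps) c
    sep with ∈-++⁻ ks u∈ | ∈-++⁻ ks v∈
    ... | inj₁ u∈ks | inj₁ v∈ks = inj₁ (u≢v ∘ dist u∈ks v∈ks)
    ... | inj₂ u∈ps | _         = inj₂ (inj₁ u∈ps)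
    ... | inj₁ _    | inj₂ v∈ps = inj₂ (inj₂ v∈ps)

  length-ear : ∀ {S ps} → Ear G S ps → ∃ λ m → length ps ≡ suc m
  length-ear {ps = []}     e = ⊥-elim (nonempty e refl)
  length-ear {ps = p ∷ ps} e = length ps , refl

  length-ears : ∀ {ks vs} → Ears G ks vs → ∃ λ m → length vs ≡ suc m
  length-ears (one e) = length-ear e
  length-ears (more {vs} {ps} es e) with m , eq ← length-ears es =
    m + length ps , trans (length-++ vs) (cong (_+ length ps) eq)

  -- Induction on the ears. Strictness is not only the goal but also the slack that `later-ear`
  -- spends, so the base case of two ears must be strict for all lengths.
  two-ears-bound : ∀ {ks vs ps} (es : Ears G ks vs) (e : Ear G (ks ++ vs) ps)
    {c : Colouring n (4 + y)} → Distinct ks c →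
    sumL (vs ++ ps) (weight (more es e)) c < D y (length (vs ++ ps))
  two-ears-bound {y} {ks} {ps = []} _ e dist = ⊥-elim (nonempty e refl)
  two-ears-bound {y} {ks} {vs} {q ∷ qs} es@(more es′ e′) e {c} dist
    with m , eq ← length-ears es = begin-strict
      sumL (vs ++ q ∷ qs) (weight (more es e)) c           ≤⟨ sumL-more≤ es e c ⟩
      sumL vs (weight es) c * suc (D y (suc (length qs)))  <⟨ later-ear y m (length qs) _ (subst (λ l → sumL vs (weight es) c < D y l) eq (two-ears-bound es′ e′ dist)) ⟩
      D y (suc m + suc (length qs))                        ≡⟨ cong (λ l → D y (l + suc (length qs))) eq ⟨
      D y (length vs + suc (length qs))                    ≡⟨ cong (D y) (length-++ vs) ⟨
      D y (length (vs ++ q ∷ qs))                          ∎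
    where open ≤-Reasoning
  two-ears-bound {y} {ks} {vs} {q ∷ r ∷ qs} es@(one e′) e {c} dist
    with m , eq ← length-ear e′ = begin-strict
      sumL (vs ++ q ∷ r ∷ qs) (weight (more es e)) c       ≤⟨ sumL-more≤ es e c ⟩
      sumL vs (weight es) c * suc (D y (2 + length qs))    ≡⟨ cong (_* suc (D y (2 + length qs))) (trans (sumL-first-ear e′ dist) (cong (D y) eq)) ⟩
      D y (suc m) * suc (D y (2 + length qs))              <⟨ second-long-ear y m (length qs) ⟩
      D y (suc m + (2 + length qs))                        ≡⟨ cong (λ l → D y (l + (2 + length qs))) eq ⟨
      D y (length vs + (2 + length qs))                    ≡⟨ cong (D y) (length-++ vs) ⟨
      D y (length (vs ++ q ∷ r ∷ qs))                      ∎
    where open ≤-Reasoning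
  two-ears-bound {y} {ks} {vs} {q ∷ []} es@(one e′) e {c} dist
    with m , eq ← length-ear e′ = begin-strict
      sumL (vs ++ [ q ]) (weight (more es e)) c            ≡⟨ sumL-more es e c ⟩
      f                                                    <⟨ second-short-ear y m f T (first-ear-differ e′ dist (s≢t e) (s∈ e) (t∈ e) eq) (total eq) ⟩
      D y (2 + m)                                          ≡⟨ cong (D y) (trans (length-++ vs) (trans (+-comm (length vs) 1) (cong suc eq))) ⟨
      D y (length (vs ++ [ q ]))                           ∎
    where
    open ≤-Reasoning
    F = λ d → earWeight e′ d * N y 1 (lookup d (s e)) (lookup d (t e))
    H = λ d → earWeight e′ d * differ (s≢t e) d
    f = sumL vs F c
    T = sumL vs H c
    total : ∀ {m} → length vs ≡ suc m → f + T ≡ D y (suc m) * (3 + y)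
    total eq = trans (≡.sym (sumL-+ vs F H c)) (trans
      (sumL-cong vs c λ d _ → trans (≡.sym (*-distribˡ-+ (earWeight e′ d) _ _))
        (cong (earWeight e′ d *_) (N-1 (lookup d (s e)) (lookup d (t e)))))
      (trans (sumL-*ʳ vs (3 + y) (earWeight e′) c)
        (cong (_* (3 + y)) (trans (sumL-first-ear e′ dist) (cong (D y) eq)))))

-- Bounds on the chromatic polynomial

unique-++ˡ : ∀ {A : Set} {as bs : List A} → Unique (as ++ bs) → Unique as
unique-++ˡ {as = []}     us         = []
unique-++ˡ {as = a ∷ as} (a∉ ∷ us) = All.++⁻ˡ as a∉ ∷ unique-++ˡ us

unique-++ʳ : ∀ {A : Set} (as : List A) {bs} → Unique (as ++ bs) → Unique bs
unique-++ʳ []       us       = us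
unique-++ʳ (a ∷ as) (_ ∷ us) = unique-++ʳ as us

unique-++-disjoint : ∀ {A : Set} {as bs : List A} → Unique (as ++ bs) → ∀ {v} → v ∈ as → v ∉ bs
unique-++-disjoint {as = a ∷ as} (a∉ ∷ us) (here refl) v∈ = All.lookup a∉ (∈-++⁺ʳ as v∈) refl
unique-++-disjoint (_ ∷ us) (there i) v∈ = unique-++-disjoint us i v∈

module _ (ks vs : List (Fin n)) (disj : ∀ {v} → v ∈ ks → v ∉ vs) (us : Unique ks)
         (F : Colouring n x → ℕ) (c : Colouring n x) where

  sumL-clique-* : sumL (ks ++ vs) (λ d → clique ks d * F d) c ≡ sumL ks (λ d → clique ks d * sumL vs F d) c
  sumL-clique-* = trans (sumL-++ ks vs _ c) (sumL-cong ks c λ d _ →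
    trans (sumL-cong vs d λ d′ agr →
             cong (_* F d′) (clique-local ks {d} {d′} λ v v∈ → agr v (disj v∈)))
          (sumL-*ˡ vs (clique ks d) F d))

  private
    factor : ∀ B → sumL ks (λ d → clique ks d * B) c ≡ falling x (length ks) * B
    factor B = trans (sumL-*ʳ ks B (clique ks) c) (cong (_* B) (sumL-clique us c))

  sumL-clique-*≤ : ∀ B → (∀ d → Distinct ks d → sumL vs F d ≤ B) →
    sumL (ks ++ vs) (λ d → clique ks d * F d) c ≤ falling x (length ks) * B
  sumL-clique-*≤ B F≤B = ≤-trans (≤-reflexive sumL-clique-*)
    (≤-trans (sumL-mono ks c λ d _ → bounded d) (≤-reflexive (factor B)))
    where
    bounded : ∀ d → clique ks d * sumL vs F d ≤ clique ks d * B
    bounded d with clique-01 ks d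
    ... | inj₁ e          = ≤-trans (≤-reflexive (cong (_* sumL vs F d) e)) z≤n
    ... | inj₂ (_ , dist) = *-monoʳ-≤ (clique ks d) (F≤B d dist)

  sumL-clique-*≡ : ∀ B → (∀ d → Distinct ks d → sumL vs F d ≡ B) →
    sumL (ks ++ vs) (λ d → clique ks d * F d) c ≡ falling x (length ks) * B
  sumL-clique-*≡ B F≡B = trans sumL-clique-* (trans (sumL-cong ks c λ d _ → exact d) (factor B))
    where
    exact : ∀ d → clique ks d * sumL vs F d ≡ clique ks d * B
    exact d with clique-01 ks d
    ... | inj₁ e          = trans (cong (_* sumL vs F d) e) (≡.sym (cong (_* B) e))
    ... | inj₂ (_ , dist) = cong (clique ks d *_) (F≡B d dist)

proper≤ : ∀ (G : Graph n) (c : Colouring n x) {w} → (Proper G c → w ≡ 1) → proper G c ≤ w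
proper≤ G c {w} = go (proper? G c)
  where
  go : ∀ {A : Set} (A? : Dec A) → (A → w ≡ 1) → (if does A? then 1 else 0) ≤ w
  go (yes a) h = ≤-reflexive (≡.sym (h a))
  go (no _)  h = z≤n

≤proper : ∀ (G : Graph n) (c : Colouring n x) {w} → w ≡ 0 ⊎ (w ≡ 1 × Proper G c) → w ≤ proper G c
≤proper G c (inj₁ e) = ≤-trans (≤-reflexive e) z≤n
≤proper G c {w} (inj₂ (e , pr)) = go (proper? G c) pr
  where
  go : ∀ {A : Set} (A? : Dec A) → A → w ≤ (if does A? then 1 else 0)
  go (yes _) _ = ≤-reflexive e
  go (no ¬a) a = ⊥-elim (¬a a)

Clique : Graph n → List (Fin n) → Set
Clique G ks = ∀ {u v} → u ∈ ks → v ∈ ks → u ≢ v → Adj G u v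

clique-proper : ∀ {G : Graph n} {ks} {c : Colouring n x} → Unique ks → Clique G ks → Proper G c → clique ks c ≡ 1
clique-proper {c = c} us K pr = clique-1 {c = c} us λ {u} {v} u∈ v∈ e → case u Fin.≟ v of λ where
  (yes u≡v) → u≡v
  (no u≢v)  → ⊥-elim (pr u v (K u∈ v∈ u≢v) e)

-- The common frame of both strict cases: `F` is any weight equal to 1 on proper colourings. A
-- strict bound for each colouring of the clique survives summation since such colourings exist,
-- that is, `falling x (length ks)` is positive.
P< : ∀ (G : Graph n) {ks vs} (F : Colouring n x → ℕ) → ks ++ vs ↭ allFin n → Unique (ks ++ vs) →
  Clique G ks → length ks ≤ x → Colouring n x → (∀ d → Proper G d → F d ≡ 1) →
  ∀ {B} → 1 ≤ B → (∀ d → Distinct ks d → sumL vs F d < B) → P G x < falling x (length ks) * B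
-- Over the natural numbers strictness below `suc B` means at most `B`, so the gap is a whole factor
-- `falling x (length ks)`.
P< {x = x} G {ks} {vs} F all us K k≤x c F-proper {suc B} _ F<B = begin-strict
  P G x                                            ≡⟨ P≡sumL G all c ⟩
  sumL (ks ++ vs) (proper G) c                     ≤⟨ sumL-mono (ks ++ vs) c (λ d _ → proper≤ G d λ pr →
                                                        cong₂ _*_ (clique-proper {G = G} {c = d} (unique-++ˡ us) K pr) (F-proper d pr)) ⟩
  sumL (ks ++ vs) (λ d → clique ks d * F d) c      ≤⟨ sumL-clique-*≤ ks vs (unique-++-disjoint us) (unique-++ˡ us) F c B
                                                        (λ d dist → ≤-pred (F<B d dist)) ⟩
  falling x (length ks) * B                        <⟨ *-monoʳ-< (falling x (length ks)) ⦃ >-nonZero (falling>0 k≤x) ⦄ ≤-refl ⟩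
  falling x (length ks) * suc B                    ∎
  where
  open ≤-Reasoning

path-proper : ∀ {G : Graph n} {c : Colouring n x} → Proper G c → ∀ s ps t → Chain (Adj G) s ps t →
  path (lookup c s) ps (lookup c t) c ≡ 1
path-proper pr s []       t st        = ne-≢ (pr s t st)
path-proper {G = G} pr s (p ∷ ps) t (sp , ch) = cong₂ _*_ (ne-≢ (pr s p sp)) (path-proper {G = G} pr p ps t ch)

path-01 : ∀ (c : Colouring n x) s ps t → path (lookup c s) ps (lookup c t) c ≡ 0 ⊎
  (path (lookup c s) ps (lookup c t) c ≡ 1 × Chain (λ u v → lookup c u ≢ lookup c v) s ps t)
path-01 c s [] t with lookup c s Fin.≟ lookup c t
... | yes _ = inj₁ refl
... | no ≢  = inj₂ (refl , ≢)
path-01 c s (p ∷ ps) t with lookup c s Fin.≟ lookup c p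
... | yes _ = inj₁ refl
... | no ≢ with path-01 c p ps t
...   | inj₁ e        = inj₁ (cong (1 *_) e)
...   | inj₂ (e , ch) = inj₂ (cong (1 *_) e , ≢ , ch)

weight-proper : ∀ {G : Graph n} {ks vs} (es : Ears G ks vs) (c : Colouring n x) → Proper G c → weight es c ≡ 1
weight-proper {G = G} (one {ps} e) c pr = path-proper {G = G} {c} pr (Ear.s e) ps (Ear.t e) (Ear.chain e)
weight-proper {G = G} (more {ps = ps} es e) c pr = cong₂ _*_ (weight-proper es c pr)
  (path-proper {G = G} {c} pr (Ear.s e) ps (Ear.t e) (Ear.chain e))

P<-two-ears : ∀ {G : Graph n} {ks vs ps} → Ears G ks vs → Ear G (ks ++ vs) ps →
  ks ++ (vs ++ ps) ↭ allFin n → Unique (ks ++ (vs ++ ps)) → Clique G ks → length ks ≤ 4 + y →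
  P G (4 + y) < falling (4 + y) (length ks) * D y (length (vs ++ ps))
P<-two-ears {n} {y} {G} {ks} {vs} {ps} es e all us K k≤x =
  P< G {ks} {vs ++ ps} (weight (more es e)) all us K k≤x (Vec.replicate n zero) (weight-proper (more es e))
     (D≥1 y (length (vs ++ ps))) (λ d dist → two-ears-bound es e dist)

-- The factor `differ` records the chord. It removes the colourings in which the ends of the chord
-- agree, and for each colouring of the clique there is at least one of these. `R` describes the
-- graph without the chord and certifies that its ends are not consecutive on the path.
P<-chord : ∀ {G : Graph n} {R : Fin n → Fin n → Set} {ks ps s t u v} →
  ks ++ ps ↭ allFin n → Unique (ks ++ ps) → Clique G ks → length ks ≤ 4 + y →
  s ∈ ks → t ∈ ks → s ≢ t → Chain (Adj G) s ps t → Chain R s ps t →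
  Adj G u v → ¬ (u ∈ ks × v ∈ ks) → ¬ R u v → ¬ R v u →
  P G (4 + y) < falling (4 + y) (length ks) * D y (length ps)
P<-chord {n} {y} {G} {R} {ks} {ps} {s} {t} {u} {v} all us K k≤x s∈ t∈ s≢t chG chR uv ¬ks ¬uv ¬vu =
  P< G {ks} {ps} F all us K k≤x (Vec.replicate n zero) F-proper (D≥1 y (length ps)) bounded
  where
  u≢v : u ≢ v
  u≢v refl = case trans (≡.sym uv) (Graph.irrefl G u) of λ ()
  us-ps : Unique ps
  us-ps = unique-++ʳ ks us
  disj : ∀ {w} → w ∈ ks → w ∉ ps
  disj = unique-++-disjoint us
  F : Colouring n (4 + y) → ℕ
  F d = path (lookup d s) ps (lookup d t) d * differ u≢v d
  F-proper : ∀ d → Proper G d → F d ≡ 1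
  F-proper d pr = cong₂ _*_ (path-proper {G = G} {d} pr s ps t chG) (ne-≢ (pr u v uv))
  member : ∀ w → w ∈ ks ⊎ w ∈ ps
  member w = ∈-++⁻ ks (Perm.∈-resp-↭ (Perm.↭-sym all) (∈-allFin w))
  bounded : ∀ d → Distinct ks d → sumL ps F d < D y (length ps)
  bounded d dist = begin-strict
    sumL ps F d
      ≡⟨ sumL-cong ps d (λ d′ agr → cong₂ (λ a b → path a ps b d′ * differ u≢v d′) (agr s (disj s∈)) (agr t (disj t∈))) ⟩
    pathSum (differ u≢v) α ps β d
      <⟨ m<m+n _ agree≥1 ⟩
    pathSum (differ u≢v) α ps β d + pathSum (agree u v) α ps β d
      ≡⟨ sumL-+ ps _ _ d ⟨
    sumL ps (λ d′ → path α ps β d′ * differ u≢v d′ + path α ps β d′ * agree u v d′) d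
      ≡⟨ sumL-cong ps d (λ d′ _ → split d′) ⟩
    sumL ps (path α ps β) d
      ≡⟨ sumL-path us-ps α β d ⟩
    N y (length ps) α β
      ≡⟨ N-≢ (length ps) (s≢t ∘ dist s∈ t∈) ⟩
    D y (length ps) ∎
    where
    open ≤-Reasoning
    α = lookup d s
    β = lookup d t
    ne+eq : ∀ {x} (a b : Fin x) → ne a b + eq a b ≡ 1
    ne+eq a b with a Fin.≟ b
    ... | yes _ = refl
    ... | no _  = refl
    split : ∀ d′ → path α ps β d′ * differ u≢v d′ + path α ps β d′ * agree u v d′ ≡ path α ps β d′
    split d′ = trans (≡.sym (*-distribˡ-+ (path α ps β d′) _ _))
      (trans (cong (path α ps β d′ *_) (ne+eq (lookup d′ u) (lookup d′ v))) (*-identityʳ _))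
    agree≥1 : 1 ≤ pathSum (agree u v) α ps β d
    agree≥1 with member u | member v
    ... | inj₁ u∈ | inj₁ v∈ = ⊥-elim (¬ks (u∈ , v∈))
    ... | inj₂ u∈ | inj₂ v∈ = pathSum-agree-inner₂ u≢v ¬uv ¬vu ps us-ps u∈ v∈ chR
    ... | inj₁ u∈ | inj₂ v∈ = pathSum-agree-inner ¬uv ¬vu ps us-ps (disj u∈) v∈ chR (dist u∈ s∈) (dist u∈ t∈)
    ... | inj₂ u∈ | inj₁ v∈ = ≤-trans
      (pathSum-agree-inner ¬vu ¬uv ps us-ps (disj v∈) u∈ chR (dist v∈ s∈) (dist v∈ t∈))
      (sumL-mono ps d λ d′ _ → ≤-reflexive (cong (path α ps β d′ *_) (agree-sym v u d′)))

-- The last hypothesis says that adjacency is the least symmetric relation containing the clique and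
-- the chain. Applied to the relation of having different colours, it makes every colouring of
-- weight 1 proper.
P≡-exact : ∀ {G : Graph n} {ks ps s t} → ks ++ ps ↭ allFin n → Unique (ks ++ ps) → Clique G ks →
  s ∈ ks → t ∈ ks → s ≢ t → Chain (Adj G) s ps t →
  (∀ (Q : Fin n → Fin n → Set) → (∀ {u v} → Q u v → Q v u) →
     (∀ {u v} → u ∈ ks → v ∈ ks → u ≢ v → Q u v) → Chain Q s ps t → ∀ u v → Adj G u v → Q u v) →
  P G (4 + y) ≡ falling (4 + y) (length ks) * D y (length ps)
P≡-exact {n} {y} {G} {ks} {ps} {s} {t} all us K s∈ t∈ s≢t ch least = begin
  P G (4 + y)                                       ≡⟨ P≡sumL G all c ⟩
  sumL (ks ++ ps) (proper G) c                      ≡⟨ sumL-cong (ks ++ ps) c (λ d _ → ≤-antisym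
                                                         (proper≤ G d λ pr → cong₂ _*_ (clique-proper {G = G} {c = d} (unique-++ˡ us) K pr)
                                                                                       (path-proper {G = G} {d} pr s ps t ch))
                                                         (≤proper G d (exact d))) ⟩
  sumL (ks ++ ps) (λ d → clique ks d * F d) c       ≡⟨ sumL-clique-*≡ ks ps disj (unique-++ˡ us) F c (D y (length ps)) count ⟩
  falling (4 + y) (length ks) * D y (length ps)     ∎
  where
  open ≡-Reasoning
  c : Colouring n (4 + y)
  c = Vec.replicate n zero
  F : Colouring n (4 + y) → ℕ
  F d = path (lookup d s) ps (lookup d t) d
  disj : ∀ {w} → w ∈ ks → w ∉ ps
  disj = unique-++-disjoint us
  exact : ∀ d → clique ks d * F d ≡ 0 ⊎ (clique ks d * F d ≡ 1 × Proper G d)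
  exact d with clique-01 ks d | path-01 d s ps t
  ... | inj₁ e          | _             = inj₁ (cong (_* F d) e)
  ... | inj₂ _          | inj₁ e        = inj₁ (trans (cong (clique ks d *_) e) (*-zeroʳ (clique ks d)))
  ... | inj₂ (e , dist) | inj₂ (e′ , ch′) = inj₂ (cong₂ _*_ e e′ ,
        least (λ u v → lookup d u ≢ lookup d v) (λ ≢ → ≢ ∘ ≡.sym) (λ u∈ v∈ u≢v → u≢v ∘ dist u∈ v∈) ch′)
  count : ∀ d → Distinct ks d → sumL ps F d ≡ D y (length ps)
  count d dist = trans
    (sumL-cong ps d λ d′ agr → cong₂ (λ a b → path a ps b d′) (agr s (disj s∈)) (agr t (disj t∈)))
    (trans (sumL-path (unique-++ʳ ks us) _ _ d) (N-≢ (length ps) (s≢t ∘ dist s∈ t∈)))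

-- The graph G_{n,k}

data GnkEdge (n k a b : ℕ) : Set where
  inside : a < k → b < k → GnkEdge n k a b
  start  : a ≡ 0 → b ≡ k → GnkEdge n k a b
  next   : k ≤ a → b ≡ suc a → suc a < n → GnkEdge n k a b
  end    : a ≡ n ∸ 1 → b ≡ 1 → GnkEdge n k a b

module _ {n k a b : ℕ} where
  open Equivalence

  GnkRaw⇒edge : Bool.T (GnkRaw n k a b) → GnkEdge n k a b
  GnkRaw⇒edge r with to (T-∨ {(a <ᵇ k) ∧ (b <ᵇ k)}) r
  ... | inj₁ h with p , q ← to (T-∧ {a <ᵇ k}) h = inside (<ᵇ⇒< a k p) (<ᵇ⇒< b k q)
  ... | inj₂ r with to (T-∨ {(a ≡ᵇ 0) ∧ (b ≡ᵇ k)}) r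
  ... | inj₁ h with p , q ← to (T-∧ {a ≡ᵇ 0}) h = start (≡ᵇ⇒≡ a 0 p) (≡ᵇ⇒≡ b k q)
  ... | inj₂ r with to (T-∨ {(k ≤ᵇ a) ∧ ((b ≡ᵇ suc a) ∧ (suc a <ᵇ n))}) r
  ... | inj₁ h with p , q ← to (T-∧ {k ≤ᵇ a}) h with q , r ← to (T-∧ {b ≡ᵇ suc a}) q =
        next (≤ᵇ⇒≤ k a p) (≡ᵇ⇒≡ b (suc a) q) (<ᵇ⇒< (suc a) n r)
  ... | inj₂ h with p , q ← to (T-∧ {a ≡ᵇ (n ∸ 1)}) h = end (≡ᵇ⇒≡ a (n ∸ 1) p) (≡ᵇ⇒≡ b 1 q)

  edge⇒GnkRaw : GnkEdge n k a b → Bool.T (GnkRaw n k a b)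
  edge⇒GnkRaw (inside p q) = from T-∨ (inj₁ (from T-∧ (<⇒<ᵇ p , <⇒<ᵇ q)))
  edge⇒GnkRaw (start p q)  = from (T-∨ {(a <ᵇ k) ∧ (b <ᵇ k)}) (inj₂ (from T-∨ (inj₁ (from T-∧ (≡⇒≡ᵇ a 0 p , ≡⇒≡ᵇ b k q)))))
  edge⇒GnkRaw (next p q r) = from (T-∨ {(a <ᵇ k) ∧ (b <ᵇ k)}) (inj₂ (from (T-∨ {(a ≡ᵇ 0) ∧ (b ≡ᵇ k)}) (inj₂
    (from T-∨ (inj₁ (from T-∧ (≤⇒≤ᵇ p , from T-∧ (≡⇒≡ᵇ b (suc a) q , <⇒<ᵇ r))))))))
  edge⇒GnkRaw (end p q)    = from (T-∨ {(a <ᵇ k) ∧ (b <ᵇ k)}) (inj₂ (from (T-∨ {(a ≡ᵇ 0) ∧ (b ≡ᵇ k)}) (inj₂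
    (from (T-∨ {(k ≤ᵇ a) ∧ ((b ≡ᵇ suc a) ∧ (suc a <ᵇ n))}) (inj₂ (from T-∧ (≡⇒≡ᵇ a (n ∸ 1) p , ≡⇒≡ᵇ b 1 q)))))))

Gnk-adj⇒ : ∀ {n k} (u v : Fin n) → Adj (Gnk n k) u v →
  u ≢ v × (GnkEdge n k (toℕ u) (toℕ v) ⊎ GnkEdge n k (toℕ v) (toℕ u))
Gnk-adj⇒ {n} {k} u v uv
  with p , q ← Equivalence.to (T-∧ {not (toℕ u ≡ᵇ toℕ v)}) (Equivalence.from T-≡ uv) =
  (λ { refl → case trans (≡.sym uv) (Graph.irrefl (Gnk n k) u) of λ () }) ,
  Sum.map (GnkRaw⇒edge {n} {k} {toℕ u}) (GnkRaw⇒edge {n} {k} {toℕ v})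
          (Equivalence.to (T-∨ {GnkRaw n k (toℕ u) (toℕ v)}) q)

Gnk-adj⇐ : ∀ {n k} (u v : Fin n) → u ≢ v → GnkEdge n k (toℕ u) (toℕ v) → Adj (Gnk n k) u v
Gnk-adj⇐ {n} {k} u v u≢v e with toℕ u ≡ᵇ toℕ v in eq
... | true  = ⊥-elim (u≢v (Fin.toℕ-injective (≡ᵇ⇒≡ (toℕ u) (toℕ v) (Equivalence.from T-≡ eq))))
... | false = Equivalence.to T-≡ (Equivalence.from (T-∨ {GnkRaw n k (toℕ u) (toℕ v)})
                (inj₁ (edge⇒GnkRaw {n} {k} {toℕ u} e)))

tabulate-+ : ∀ {A : Set} k p (f : Fin (k + p) → A) →
  List.tabulate f ≡ List.tabulate (f ∘ (Fin._↑ˡ p)) ++ List.tabulate (f ∘ (k Fin.↑ʳ_))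
tabulate-+ zero    p f = refl
tabulate-+ (suc k) p f = cong (f zero ∷_) (tabulate-+ k p (f ∘ suc))

module _ {n : ℕ} (Q : Fin n → Fin n → Set) where

  Chain-tabulate⁺ : ∀ {s t} q (f : Fin (suc q) → Fin n) → Q s (f zero) →
    (∀ i → Q (f (Fin.inject₁ i)) (f (suc i))) → Q (f (Fin.fromℕ q)) t → Chain Q s (List.tabulate f) t
  Chain-tabulate⁺ zero    f fst nxt lst = fst , lst
  Chain-tabulate⁺ (suc q) f fst nxt lst = fst , Chain-tabulate⁺ q (f ∘ suc) (nxt zero) (nxt ∘ suc) lst

  Chain-first : ∀ {s t} q (f : Fin (suc q) → Fin n) → Chain Q s (List.tabulate f) t → Q s (f zero)
  Chain-first q f (fst , _) = fst

  Chain-next : ∀ {s t} q (f : Fin (suc q) → Fin n) → Chain Q s (List.tabulate f) t →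
    ∀ i → Q (f (Fin.inject₁ i)) (f (suc i))
  Chain-next (suc q) f (_ , ch) zero    = Chain-first q (f ∘ suc) ch
  Chain-next (suc q) f (_ , ch) (suc i) = Chain-next q (f ∘ suc) ch i

  Chain-last : ∀ {s t} q (f : Fin (suc q) → Fin n) → Chain Q s (List.tabulate f) t → Q (f (Fin.fromℕ q)) t
  Chain-last zero    f (_ , lst) = lst
  Chain-last (suc q) f (_ , ch)  = Chain-last q (f ∘ suc) ch

module _ {n m : ℕ} (Q : Fin n → Fin n → Set) (h : Fin m → Fin n) where

  Chain-pull : ∀ {s t} p (f : Fin p → Fin m) → Chain Q (h s) (List.tabulate (h ∘ f)) (h t) →
    Chain (λ u v → Q (h u) (h v)) s (List.tabulate f) t
  Chain-pull zero    f ch         = ch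
  Chain-pull (suc p) f (fst , ch) = fst , Chain-pull p (f ∘ suc) ch

module GnkStructure (j q : ℕ) where

  -- The shape `2 + j` makes the attaching vertices 0 and 1 available as `zero` and `suc zero`, and
  -- `suc q` makes the path nonempty.
  k p : ℕ
  k = 2 + j
  p = suc q

  ks ps : List (Fin (k + p))
  ks = List.tabulate {n = k} (Fin._↑ˡ p)
  ps = List.tabulate {n = p} (k Fin.↑ʳ_)

  s t : Fin (k + p)
  s = zero
  t = suc zero

  ks++ps : allFin (k + p) ≡ ks ++ ps
  ks++ps = tabulate-+ k p id

  ks++ps-unique : Unique (ks ++ ps)
  ks++ps-unique = subst Unique ks++ps (allFin⁺ (k + p))

  ∈ks⇒< : ∀ {u} → u ∈ ks → toℕ u < k
  ∈ks⇒< u∈ with i , refl ← ∈-tabulate⁻ {n = k} {f = Fin._↑ˡ p} u∈ =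
    subst (_< k) (≡.sym (Fin.toℕ-↑ˡ i p)) (Fin.toℕ<n i)

  <⇒∈ks : ∀ {u} → toℕ u < k → u ∈ ks
  <⇒∈ks {u} u<k = subst (_∈ ks)
    (Fin.toℕ-injective (trans (Fin.toℕ-↑ˡ (Fin.fromℕ< u<k) p) (Fin.toℕ-fromℕ< u<k)))
    (∈-tabulate⁺ {f = Fin._↑ˡ p} (Fin.fromℕ< u<k))

  K : Clique (Gnk (k + p) k) ks
  K {u} {v} u∈ v∈ u≢v = Gnk-adj⇐ u v u≢v (inside (∈ks⇒< u∈) (∈ks⇒< v∈))

  toℕ-inner : ∀ (i : Fin p) → toℕ (k Fin.↑ʳ i) ≡ k + toℕ i
  toℕ-inner = Fin.toℕ-↑ʳ k

  last-index : k + p ∸ 1 ≡ k + q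
  last-index = +-suc (suc j) q

  ch : Chain (Adj (Gnk (k + p) k)) s ps t
  ch = Chain-tabulate⁺ (Adj (Gnk (k + p) k)) {s} {t} q (k Fin.↑ʳ_)
    (Gnk-adj⇐ {k + p} {k} s _ (λ ()) (start refl (trans (toℕ-inner zero) (+-identityʳ k))))
    (λ i → Gnk-adj⇐ {k + p} {k} _ _
      (λ e → 1+n≢n (trans (≡.sym (cong toℕ (Fin.↑ʳ-injective k _ _ e))) (Fin.toℕ-inject₁ i)))
      (next (≤-trans (m≤m+n k _) (≤-reflexive (≡.sym (toℕ-inner (Fin.inject₁ i)))))
            (consecutive i)
            (subst (_< k + p) (consecutive i) (Fin.toℕ<n (k Fin.↑ʳ suc i)))))
    (Gnk-adj⇐ {k + p} {k} _ t (λ e → case cong toℕ e of λ ())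
      (end (trans (toℕ-inner (Fin.fromℕ q)) (trans (cong (k +_) (Fin.toℕ-fromℕ q)) (≡.sym last-index))) refl))
    where
    consecutive : ∀ i → toℕ (k Fin.↑ʳ suc i) ≡ suc (toℕ (k Fin.↑ʳ Fin.inject₁ i))
    consecutive i = trans (toℕ-inner (suc i)) (trans (+-suc k (toℕ i))
      (cong suc (trans (cong (k +_) (≡.sym (Fin.toℕ-inject₁ i))) (≡.sym (toℕ-inner (Fin.inject₁ i))))))

  least : ∀ (Q : Fin (k + p) → Fin (k + p) → Set) → (∀ {u v} → Q u v → Q v u) →
    (∀ {u v} → u ∈ ks → v ∈ ks → u ≢ v → Q u v) → Chain Q s ps t →
    ∀ u v → Adj (Gnk (k + p) k) u v → Q u v
  least Q Q-sym Q-ks Q-ch u v uv = case Gnk-adj⇒ u v uv of λ where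
      (u≢v , inj₁ e) → edge u v u≢v e
      (u≢v , inj₂ e) → Q-sym (edge v u (u≢v ∘ ≡.sym) e)
    where
    edge : ∀ u v → u ≢ v → GnkEdge (k + p) k (toℕ u) (toℕ v) → Q u v
    edge u v u≢v (inside u<k v<k) = Q-ks (<⇒∈ks u<k) (<⇒∈ks v<k) u≢v
    edge u v _ (start u≡0 v≡k) = subst₂ Q (Fin.toℕ-injective (≡.sym u≡0))
      (Fin.toℕ-injective (trans (toℕ-inner zero) (trans (+-identityʳ k) (≡.sym v≡k))))
      (Chain-first Q {s} {t} q (k Fin.↑ʳ_) Q-ch)
    edge u v _ (next k≤u v≡ u<) = subst₂ Q
      (Fin.toℕ-injective (trans (toℕ-inner (Fin.inject₁ i))
        (trans (cong (k +_) (trans (Fin.toℕ-inject₁ i) (Fin.toℕ-fromℕ< i<q))) (m+[n∸m]≡n k≤u))))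
      (Fin.toℕ-injective (trans (toℕ-inner (suc i)) (trans (+-suc k (toℕ i))
        (trans (cong suc (trans (cong (k +_) (Fin.toℕ-fromℕ< i<q)) (m+[n∸m]≡n k≤u))) (≡.sym v≡)))))
      (Chain-next Q {s} {t} q (k Fin.↑ʳ_) Q-ch i)
      where
      i<q : toℕ u ∸ k < q
      i<q = +-cancelˡ-< k _ _ (subst (_< k + q) (≡.sym (m+[n∸m]≡n k≤u))
        (≤-pred (subst (suc (toℕ u) <_) (+-suc k q) u<)))
      i = Fin.fromℕ< i<q
    edge u v _ (end u≡ v≡1) = subst₂ Q
      (Fin.toℕ-injective (trans (toℕ-inner (Fin.fromℕ q))
        (trans (cong (k +_) (Fin.toℕ-fromℕ q)) (≡.sym (trans u≡ last-index)))))
      (Fin.toℕ-injective (≡.sym v≡1))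
      (Chain-last Q {s} {t} q (k Fin.↑ʳ_) Q-ch)

  length-ks : length ks ≡ k
  length-ks = length-tabulate {n = k} (Fin._↑ˡ p)

  length-ps : length ps ≡ p
  length-ps = length-tabulate {n = p} (k Fin.↑ʳ_)

  P-Gnk : ∀ y → P (Gnk (k + p) k) (4 + y) ≡ falling (4 + y) k * D y p
  P-Gnk y = trans
    (P≡-exact {y = y} {G = Gnk (k + p) k} (Perm.↭-reflexive (≡.sym ks++ps)) ks++ps-unique K
      (here refl) (there (here refl)) (λ ()) ch least)
    (cong₂ (λ a b → falling (4 + y) a * D y b) length-ks length-ps)

-- Isomorphism invariance and ear decompositions

spanning-↭ : ∀ {n} {vs : List (Fin n)} → Unique vs → (∀ v → v ∈ vs) → vs ↭ allFin n
spanning-↭ {n} us all = ∼bag⇒↭ (unique∧set⇒bag us (allFin⁺ n) (mk⇔ (λ _ → ∈-allFin _) (λ _ → all _)))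

proper-1 : ∀ {n x} (G : Graph n) (c : Colouring n x) → Proper G c → 1 ≤ proper G c
proper-1 G c pr = ≤proper G c (inj₂ (refl , pr))

module _ {n x : ℕ} {G H : Graph n} (iso : G ≅ H) where
  open Inverse (proj₁ iso) using (to; from; inverseˡ; inverseʳ)

  private
    adj≡ : ∀ u v → adj H (to u) (to v) ≡ adj G u v
    adj≡ = proj₂ iso

    to-from : ∀ v → to (from v) ≡ v
    to-from v = inverseˡ refl

    from-to : ∀ v → from (to v) ≡ v
    from-to v = inverseʳ refl

    pull : Colouring n x → Colouring n x
    pull c = tabulate (lookup c ∘ to)

    pull-update : ∀ c v z → pull (c [ v ]≔ z) ≡ pull c [ from v ]≔ z
    pull-update c v z = trans (tabulate-cong pointwise) (tabulate∘lookup (pull c [ from v ]≔ z))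
      where
      pointwise : ∀ u → lookup (c [ v ]≔ z) (to u) ≡ lookup (pull c [ from v ]≔ z) u
      pointwise u with to u Fin.≟ v
      ... | yes refl = trans (lookup∘update (to u) c z)
              (≡.sym (trans (cong (λ w → lookup (pull c [ w ]≔ z) u) (from-to u)) (lookup∘update u (pull c) z)))
      ... | no tu≢v = trans (lookup∘update′ tu≢v c z) (≡.sym
              (trans (lookup∘update′ (λ u≡ → tu≢v (trans (cong to u≡) (to-from v))) (pull c) z)
                     (lookup∘tabulate (lookup c ∘ to) u)))

    sumL-pull : ∀ vs (F : Colouring n x → ℕ) c → sumL vs (F ∘ pull) c ≡ sumL (map from vs) F (pull c)
    sumL-pull []       F c = refl
    sumL-pull (v ∷ vs) F c = sum-cong-≗ λ z → trans (sumL-pull vs F (c [ v ]≔ z))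
      (cong (sumL (map from vs) F) (pull-update c v z))

    pull-proper : ∀ c → Proper H c → Proper G (pull c)
    pull-proper c pr u v uv e = pr (to u) (to v) (trans (adj≡ u v) uv)
      (trans (≡.sym (lookup∘tabulate (lookup c ∘ to) u)) (trans e (lookup∘tabulate (lookup c ∘ to) v)))

    pull-proper⁻ : ∀ c → Proper G (pull c) → Proper H c
    pull-proper⁻ c pr u v uv e = pr (from u) (from v)
      (trans (≡.sym (adj≡ (from u) (from v))) (trans (cong₂ (adj H) (to-from u) (to-from v)) uv))
      (trans (read u) (trans e (≡.sym (read v))))
      where
      read : ∀ u → lookup (pull c) (from u) ≡ lookup c u
      read u = trans (lookup∘tabulate (lookup c ∘ to) (from u)) (cong (lookup c) (to-from u))

    proper-pull : ∀ c → proper H c ≡ proper G (pull c)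
    proper-pull c = ≤-antisym
      (proper≤ H c λ pr → ≤-antisym (proper≤ G (pull c) λ _ → refl) (proper-1 G (pull c) (pull-proper c pr)))
      (proper≤ G (pull c) λ pr → ≤-antisym (proper≤ H c λ _ → refl) (proper-1 H c (pull-proper⁻ c pr)))

  -- Colourings are pulled back along the bijection. Overwriting at `v` becomes overwriting at
  -- `from v`, so the sum only changes the order in which it lists the vertices.
  P-≅ : Colouring n x → P G x ≡ P H x
  P-≅ c = begin
    P G x                                             ≡⟨ P≡sumL G image (pull c) ⟩
    sumL (map from (allFin n)) (proper G) (pull c)    ≡⟨ sumL-pull (allFin n) (proper G) c ⟨
    sumL (allFin n) (proper G ∘ pull) c               ≡⟨ sumL-cong (allFin n) c (λ d _ → ≡.sym (proper-pull d)) ⟩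
    sumL (allFin n) (proper H) c                      ≡⟨ P≡sumL H Perm.↭-refl c ⟨
    P H x                                             ∎
    where
    open ≡-Reasoning
    image : map from (allFin n) ↭ allFin n
    image = spanning-↭
      (Unique.map⁺ (λ {u} {v} e → trans (≡.sym (to-from u)) (trans (cong to e) (to-from v))) (allFin⁺ n))
      (λ v → subst (_∈ map from (allFin n)) (from-to v) (∈-map⁺ from (∈-allFin (to v))))

-- Ears from 2-connectedness

module _ {n : ℕ} (G : Graph n) where
  open DecMembership (Fin._≟_ {n}) using (_∈?_)

  module _ (S : List (Fin n)) where

    crossing : ∀ {ok u v} → Walk G ok u v → u ∈ S → v ∉ S → ∃ λ a → ∃ λ b → a ∈ S × b ∉ S × Adj G a b
    crossing (here _) u∈ v∉ = ⊥-elim (v∉ u∈)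
    crossing (step {u} {w} _ uw walk) u∈ v∉ with w ∈? S
    ... | yes w∈ = crossing walk w∈ v∉
    ... | no w∉  = u , w , u∈ , w∉ , uw

    OutsidePath : Fin n → Fin n → Set
    OutsidePath u t = ∃ λ ps → Chain (Adj G) u ps t × Unique (u ∷ ps) × All (_∉ S) (u ∷ ps)

    suffix : ∀ {u w t} ps → u ∈ w ∷ ps → Chain (Adj G) w ps t → Unique (w ∷ ps) → All (_∉ S) (w ∷ ps) →
      OutsidePath u t
    suffix ps       (here refl) ch       us       out       = ps , ch , us , out
    suffix (p ∷ ps) (there u∈)  (_ , ch) (_ ∷ us) (_ ∷ out) = suffix ps u∈ ch us out

    start-ok : ∀ {ok u v} → Walk G ok u v → ok u
    start-ok (here o)     = o
    start-ok (step o _ _) = o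

    -- The walk is cut at its first vertex in `S`, and loops are erased from its end backwards: if
    -- `u` recurs, only the part from that occurrence on is kept. Returning `ok t` tells that the
    -- end avoids a deleted vertex.
    firstReturn : ∀ {ok u v} → Walk G ok u v → u ∉ S → v ∈ S → ∃ λ t → t ∈ S × ok t × OutsidePath u t
    firstReturn (here _) u∉ v∈ = ⊥-elim (u∉ v∈)
    firstReturn (step {u} {w} _ uw walk) u∉ v∈ with w ∈? S
    ... | yes w∈ = w , w∈ , start-ok walk , [] , uw , ([] ∷ []) , (u∉ ∷ [])
    ... | no w∉ with t , t∈ , ok-t , ps , ch , us , out ← firstReturn walk w∉ v∈ with u ∈? (w ∷ ps)
    ...   | yes u∈ = t , t∈ , ok-t , suffix ps u∈ ch us out
    ...   | no u∉′ = t , t∈ , ok-t , w ∷ ps , (uw , ch) ,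
              (All.tabulate (λ { i refl → u∉′ i }) ∷ us) , (u∉ ∷ out)

    -- The ear leaves `S` along an edge from `a` to `b` and returns from `b` by a walk avoiding `a`,
    -- so its ends differ. The two distinct members of `S` guarantee a target other than `a`.
    newEar : TwoConnected G → ∀ {s t v} → s ∈ S → t ∈ S → s ≢ t → v ∉ S → ∃ λ ps → Ear G S ps
    newEar (_ , conn , conn-) {s} {t} {v} s∈ t∈ s≢t v∉
      with a , b , a∈ , b∉ , ab ← crossing (conn s v) s∈ v∉ =
      let r , r∈ , r≢a = other a
          t′ , t′∈ , t′≢a , ps , ch , us , out = firstReturn (conn- a b r (λ { refl → b∉ a∈ }) r≢a) b∉ r∈
      in b ∷ ps , record
        { s = a ; t = t′ ; s∈ = a∈ ; t∈ = t′∈ ; s≢t = t′≢a ∘ ≡.sym ; chain = ab , ch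
        ; unique = us ; disjoint = All.lookup out ; nonempty = λ () }
      where
      other : ∀ a → ∃ λ r → r ∈ S × r ≢ a
      other a with s Fin.≟ a
      ... | yes refl = t , t∈ , s≢t ∘ ≡.sym
      ... | no s≢a   = s , s∈ , s≢a

  -- Vertices are read as colours, so that `sum-nes` counts the vertices missing from `vs`.
  unique-length≤ : ∀ {vs : List (Fin n)} → Unique vs → length vs ≤ n
  unique-length≤ {vs} us = subst (length vs ≤_) (sum-nes us) (m≤n+m _ _)

  private
    extend : ∀ {S ps} → Unique S → Ear G S ps → Unique (S ++ ps)
    extend us e = Unique.++⁺ us (Ear.unique e) λ { (v∈S , v∈ps) → Ear.disjoint e v∈ps v∈S }

    grow : TwoConnected G → ∀ {ks s t} → s ∈ ks → t ∈ ks → s ≢ t → ∀ fuel {vs} → Ears G ks vs →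
      Unique (ks ++ vs) → n ≤ length (ks ++ vs) + fuel →
      ∃ λ ws → Ears G ks ws × Unique (ks ++ ws) × (∀ v → v ∈ ks ++ ws)
    grow 2c {ks} s∈ t∈ s≢t fuel {vs} es us enough with Fin.all? (λ v → v ∈? (ks ++ vs))
    ... | yes all = vs , es , us , all
    ... | no ¬all with v , v∉ ← Fin.¬∀⟶∃¬ n _ (λ v → v ∈? (ks ++ vs)) ¬all with fuel
    -- Without fuel the list has `n` distinct vertices already, and `v` would be one more.
    ...   | zero = ⊥-elim (<-irrefl refl (≤-trans (s≤s (subst (n ≤_) (+-identityʳ _) enough))
              (unique-length≤ (All.tabulate (λ { i refl → v∉ i }) ∷ us))))
    ...   | suc fuel with ps , e ← newEar (ks ++ vs) 2c (∈-++⁺ˡ s∈) (∈-++⁺ˡ t∈) s≢t v∉ =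
        grow 2c s∈ t∈ s≢t fuel (more es e) (subst Unique (++-assoc ks vs ps) (extend us e)) (begin
          n                                       ≤⟨ enough ⟩
          length (ks ++ vs) + suc fuel            ≡⟨ +-suc _ fuel ⟩
          suc (length (ks ++ vs)) + fuel          ≤⟨ +-monoˡ-≤ fuel (longer e) ⟩
          length ((ks ++ vs) ++ ps) + fuel        ≡⟨ cong (λ l → length l + fuel) (++-assoc ks vs ps) ⟩
          length (ks ++ (vs ++ ps)) + fuel        ∎)
      where
      open ≤-Reasoning
      longer : ∀ {S ps} → Ear G S ps → length S < length (S ++ ps)
      longer {S} e with m , eq ← length-ear e =
        subst (length S <_) (≡.sym (trans (length-++ S) (cong (length S +_) eq))) (m<m+n (length S) (s≤s z≤n))

  ear-decomposition : TwoConnected G → ∀ {ks s t v} → Unique ks → s ∈ ks → t ∈ ks → s ≢ t → v ∉ ks →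
    ∃ λ vs → Ears G ks vs × Unique (ks ++ vs) × (∀ v → v ∈ ks ++ vs)
  ear-decomposition 2c {ks} us s∈ t∈ s≢t v∉ with ps , e ← newEar ks 2c s∈ t∈ s≢t v∉ =
    grow 2c s∈ t∈ s≢t n (one e) (extend us e) (m≤n+m n _)

-- Graphs spanned by a clique and one ear

two-first : ∀ {A : Set} {s t : A} {ks} → s ∈ ks → t ∈ ks → s ≢ t → ∃ λ rest → ks ↭ s ∷ t ∷ rest
two-first {s = s} {t} s∈ t∈ s≢t with as , bs , refl ← ∈-∃++ s∈
  with Perm.∈-resp-↭ (Perm.shift s as bs) t∈
... | here t≡s = ⊥-elim (s≢t (≡.sym t≡s))
... | there t∈′ with cs , ds , eq ← ∈-∃++ t∈′ =
  cs ++ ds , Perm.trans (Perm.shift s as bs)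
    (prep s (Perm.trans (Perm.↭-reflexive eq) (Perm.shift t cs ds)))

++-split : ∀ {A : Set} {as bs cs ds : List A} → length as ≡ length cs → as ++ bs ≡ cs ++ ds → as ≡ cs × bs ≡ ds
++-split {as = []}     {cs = []}     _ eq = refl , eq
++-split {as = a ∷ as} {cs = c ∷ cs} l eq with ∷-injective eq
... | refl , eq′ with ++-split {as = as} {cs = cs} (suc-injective l) eq′
...   | refl , refl = refl , refl

fromList : ∀ {A : Set} {m} (vs : List A) → length vs ≡ m → ∃ λ (f : Fin m → A) → List.tabulate f ≡ vs
fromList vs refl = List.lookup vs , tabulate-lookup vs

extra-edge? : ∀ {n} (G H : Graph n) → (∀ u v → Adj H u v → Adj G u v) →
  (∃ λ u → ∃ λ v → Adj G u v × ¬ Adj H u v) ⊎ (∀ u v → adj G u v ≡ adj H u v)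
extra-edge? {n} G H H⊆G with Fin.any? (λ u → Fin.any? λ v → (adj G u v Bool.≟ true) ×-dec ¬? (adj H u v Bool.≟ true))
... | yes found = inj₁ found
... | no none   = inj₂ same
  where
  same : ∀ u v → adj G u v ≡ adj H u v
  same u v with adj G u v Bool.≟ true | adj H u v Bool.≟ true
  ... | yes a | yes b = trans a (≡.sym b)
  ... | no a  | no b  = trans (¬-not a) (≡.sym (¬-not b))
  ... | yes a | no b  = ⊥-elim (none (u , v , a , b))
  ... | no a  | yes b = ⊥-elim (a (H⊆G u v b))

module _ (j q y : ℕ) where
  open GnkStructure j q
  open PermSetoid (≡.setoid (Fin (k + p))) using (Unique-resp-↭)

  -- `ℓ` lists the vertices in the order of `Gnk`: the ends of the ear, the rest of the clique, then
  -- the ear from end to end. Read through `ℓ`, the graph contains `Gnk` by `least`; so either it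
  -- has a further edge, which acts as a chord, or it is `Gnk`.
  relabelled : ∀ (G : Graph (k + p)) {ks₀ ps₀ s₀ t₀ rest} (ℓ : Fin (k + p) → Fin (k + p)) →
    List.tabulate ℓ ↭ allFin (k + p) → List.tabulate {n = k} (ℓ ∘ (Fin._↑ˡ p)) ≡ s₀ ∷ t₀ ∷ rest →
    List.tabulate {n = p} (ℓ ∘ (k Fin.↑ʳ_)) ≡ ps₀ → ks₀ ↭ s₀ ∷ t₀ ∷ rest → Chain (Adj G) s₀ ps₀ t₀ →
    Clique G ks₀ → k ≤ 4 + y →
    P G (4 + y) < falling (4 + y) k * D y p ⊎ G ≅ Gnk (k + p) k
  relabelled G {ks₀} {ps₀} {s₀} {t₀} ℓ image↭ eqˡ eqʳ ks₀↭ ch₀ K₀ k≤x = Sum.map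
    (λ (u , v , uv , ¬uv) → chord u v uv ¬uv)
    (λ same → relabel , λ u v → trans (≡.sym (same _ _)) (proj₂ G≅G′ u v))
    (extra-edge? G′ (Gnk (k + p) k)
      (least (Adj G′) (λ {u} {v} uv → trans (Graph.sym G′ v u) uv) K′ ch′))
    where
    ℓ-injective : ∀ {u v} → ℓ u ≡ ℓ v → u ≡ v
    ℓ-injective = Unique-map⇒injective {vs = allFin (k + p)}
      (subst Unique (≡.sym (map-tabulate id ℓ))
        (Unique-resp-↭ (Perm.↭⇒↭ₛ (Perm.↭-sym image↭)) (allFin⁺ (k + p))))
      (∈-allFin _) (∈-allFin _)
    position : ∀ v → ∃ λ u → v ≡ ℓ u
    position v = ∈-tabulate⁻ (Perm.∈-resp-↭ (Perm.↭-sym image↭) (∈-allFin v))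
    G′ : Graph (k + p)
    G′ = record
      { adj    = λ u v → adj G (ℓ u) (ℓ v)
      ; sym    = λ u v → Graph.sym G (ℓ u) (ℓ v)
      ; irrefl = λ u → Graph.irrefl G (ℓ u) }
    relabel : Fin (k + p) ↔ Fin (k + p)
    relabel = mk↔ₛ′ (proj₁ ∘ position) ℓ
      (λ u → ℓ-injective (≡.sym (proj₂ (position (ℓ u))))) (λ v → ≡.sym (proj₂ (position v)))
    G≅G′ : G ≅ G′
    G≅G′ = relabel , λ u v → cong₂ (adj G) (≡.sym (proj₂ (position u))) (≡.sym (proj₂ (position v)))
    ℓ∈ks₀ : ∀ {u} → u ∈ ks → ℓ u ∈ ks₀
    ℓ∈ks₀ u∈ with i , refl ← ∈-tabulate⁻ {n = k} {f = Fin._↑ˡ p} u∈ =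
      Perm.∈-resp-↭ (Perm.↭-sym ks₀↭) (subst (ℓ (i Fin.↑ˡ p) ∈_) eqˡ (∈-tabulate⁺ {n = k} {f = ℓ ∘ (Fin._↑ˡ p)} i))
    K′ : Clique G′ ks
    K′ u∈ v∈ u≢v = K₀ (ℓ∈ks₀ u∈) (ℓ∈ks₀ v∈) (u≢v ∘ ℓ-injective)
    ch′ : Chain (Adj G′) s ps t
    ch′ = Chain-pull (Adj G) ℓ p (k Fin.↑ʳ_) (subst₂ (λ a b → Chain (Adj G) a (List.tabulate (ℓ ∘ (k Fin.↑ʳ_))) b)
      (≡.sym (∷-injectiveˡ eqˡ)) (≡.sym (∷-injectiveˡ (∷-injectiveʳ eqˡ)))
      (subst (λ l → Chain (Adj G) s₀ l t₀) (≡.sym eqʳ) ch₀))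
    chord : ∀ u v → Adj G′ u v → ¬ Adj (Gnk (k + p) k) u v → P G (4 + y) < falling (4 + y) k * D y p
    chord u v uv ¬uv = subst₂ _<_ (≡.sym (P-≅ {G = G} {G′} G≅G′ (Vec.replicate (k + p) zero)))
      (cong₂ (λ a b → falling (4 + y) a * D y b) length-ks length-ps)
      (P<-chord {G = G′} {R = Adj (Gnk (k + p) k)} (Perm.↭-reflexive (≡.sym ks++ps)) ks++ps-unique K′
        (subst (_≤ 4 + y) (≡.sym length-ks) k≤x) (here refl) (there (here refl)) (λ ()) ch′ ch uv
        (λ (u∈ , v∈) → ¬uv (K u∈ v∈ λ { refl → case trans (≡.sym uv) (Graph.irrefl G′ u) of λ () }))
        ¬uv (λ vu → ¬uv (trans (Graph.sym (Gnk (k + p) k) u v) vu)))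

  single-ear : ∀ (G : Graph (k + p)) {ks₀ ps₀} → Ear G ks₀ ps₀ → ks₀ ++ ps₀ ↭ allFin (k + p) →
    length ks₀ ≡ k → Clique G ks₀ → k ≤ 4 + y →
    P G (4 + y) < falling (4 + y) k * D y p ⊎ G ≅ Gnk (k + p) k
  single-ear G {ks₀} {ps₀} e span len =
    -- The ends of the ear come first in the clique, to match the vertices 0 and 1 at which the path
    -- of `Gnk` is attached.
    let rest , ks₀↭ = two-first (Ear.s∈ e) (Ear.t∈ e) (Ear.s≢t e)
        L↭ = Perm.trans (Perm.++⁺ʳ ps₀ (Perm.↭-sym ks₀↭)) span
        ℓ , ℓ≡ = fromList (Ear.s e ∷ Ear.t e ∷ rest ++ ps₀)
          (trans (Perm.↭-length L↭) (length-tabulate {n = k + p} id))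
        eqˡ , eqʳ = ++-split {as = List.tabulate {n = k} (ℓ ∘ (Fin._↑ˡ p))} {cs = Ear.s e ∷ Ear.t e ∷ rest}
          (trans (length-tabulate {n = k} (ℓ ∘ (Fin._↑ˡ p))) (trans (≡.sym len) (Perm.↭-length ks₀↭)))
          (trans (≡.sym (tabulate-+ k p ℓ)) ℓ≡)
    in relabelled G ℓ (Perm.trans (Perm.↭-reflexive ℓ≡) L↭) eqˡ eqʳ ks₀↭ (Ear.chain e)

  extremal : ∀ (G : Graph (k + p)) → TwoConnected G → HasClique G k → k ≤ 4 + y →
    P G (4 + y) < falling (4 + y) k * D y p ⊎ G ≅ Gnk (k + p) k
  extremal G 2c (f , f-injective , f-clique) k≤x =
    by-ears (ear-decomposition G 2c us (∈-tabulate⁺ {f = f} zero) (∈-tabulate⁺ {f = f} (suc zero))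
      (λ e → case f-injective _ _ e of λ ()) (proj₂ missing))
    where
    open DecMembership (Fin._≟_ {k + p}) using (_∈?_)
    ks₀ = List.tabulate f
    len : length ks₀ ≡ k
    len = length-tabulate f
    us : Unique ks₀
    us = Unique.tabulate⁺ (λ {u} {v} → f-injective u v)
    K₀ : Clique G ks₀
    K₀ u∈ v∈ u≢v with i , refl ← ∈-tabulate⁻ {f = f} u∈ | i′ , refl ← ∈-tabulate⁻ {f = f} v∈ =
      f-clique i i′ λ { refl → u≢v refl }
    missing : ∃ λ v → v ∉ ks₀
    missing = Fin.¬∀⟶∃¬ (k + p) _ (_∈? ks₀) λ all → <-irrefl
      (trans (≡.sym len) (trans (Perm.↭-length (spanning-↭ us all)) (length-tabulate {n = k + p} id)))
      (m<m+n k (s≤s z≤n))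
    by-ears : (∃ λ vs → Ears G ks₀ vs × Unique (ks₀ ++ vs) × (∀ v → v ∈ ks₀ ++ vs)) →
      P G (4 + y) < falling (4 + y) k * D y p ⊎ G ≅ Gnk (k + p) k
    by-ears (_ , one e , us′ , all) = single-ear G e (spanning-↭ us′ all) len K₀ k≤x
    by-ears (_ , more {vs} {ps} es e , us′ , all) = inj₁ (subst₂ (λ a b → P G (4 + y) < falling (4 + y) a * D y b)
      len len-vs (P<-two-ears es e (spanning-↭ us′ all) us′ K₀ (subst (_≤ 4 + y) (≡.sym len) k≤x)))
      where
      len-vs : length (vs ++ ps) ≡ p
      len-vs = +-cancelˡ-≡ k _ _ (trans (cong (_+ length (vs ++ ps)) (≡.sym len))
        (trans (≡.sym (length-++ ks₀)) (trans (Perm.↭-length (spanning-↭ us′ all)) (length-tabulate {n = k + p} id))))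

-- Imported only here: as a prefix operator, +_ makes sections of _+_ ambiguous.
open import Data.Integer using (ℤ; +_; -[1+_]) renaming (_≤_ to _≤ℤ_)

-- The closed form of the bound

module _ (y : ℕ) where
  private
    w : ℤ
    w = + y

    pow sgn : ℕ → ℤ
    pow m = (+ (3 + y)) ℤ.^ m
    sgn m = -[1+ 0 ] ℤ.^ m

    pos-pow : ∀ m → + ((3 + y) ^ m) ≡ pow m
    pos-pow zero    = refl
    pos-pow (suc m) = trans (ℤ.pos-* (3 + y) ((3 + y) ^ m)) (cong ((+ (3 + y)) ℤ.*_) (pos-pow m))

    +D : ∀ m → + D y (suc m) ≡ + E y m ℤ.+ (+ 2 ℤ.+ w) ℤ.* + D y m
    +D m = trans (ℤ.pos-+ (E y m) _) (cong (λ a → + E y m ℤ.+ a) (ℤ.pos-* (2 + y) (D y m)))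

    +E : ∀ m → + E y (suc m) ≡ (+ 3 ℤ.+ w) ℤ.* + D y m
    +E m = ℤ.pos-* (3 + y) (D y m)

    -- These are the numbers of walks of length `m + 1` in the complete graph on `x` vertices, whose
    -- adjacency matrix has the eigenvalues `x - 1` and `-1`. The factor `x = 4 + w` clears the
    -- denominator.
    closed : ∀ m → ((+ 4 ℤ.+ w) ℤ.* + D y m ≡ pow (suc m) ℤ.+ sgn m) ×
                   ((+ 4 ℤ.+ w) ℤ.* + E y m ≡ pow (suc m) ℤ.+ sgn (suc m) ℤ.* (+ 3 ℤ.+ w))
    closed zero = solve 1 (λ w → (con (+ 4) :+ w) :* con (+ 1) := (con (+ 3) :+ w) :* con (+ 1) :+ con (+ 1)) refl w ,
                  solve 1 (λ w → (con (+ 4) :+ w) :* con (+ 0) := (con (+ 3) :+ w) :* con (+ 1) :+ con -[1+ 0 ] :* con (+ 1) :* (con (+ 3) :+ w)) refl w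
      where open ℤ-Solver
    closed (suc m) with d , e ← closed m =
        (begin
          (+ 4 ℤ.+ w) ℤ.* + D y (suc m)                                            ≡⟨ cong ((+ 4 ℤ.+ w) ℤ.*_) (+D m) ⟩
          (+ 4 ℤ.+ w) ℤ.* (+ E y m ℤ.+ (+ 2 ℤ.+ w) ℤ.* + D y m)                    ≡⟨ solve 3 (λ w d e → (con (+ 4) :+ w) :* (e :+ (con (+ 2) :+ w) :* d) :=
                                                                                         (con (+ 4) :+ w) :* e :+ (con (+ 2) :+ w) :* ((con (+ 4) :+ w) :* d)) refl w (+ D y m) (+ E y m) ⟩
          (+ 4 ℤ.+ w) ℤ.* + E y m ℤ.+ (+ 2 ℤ.+ w) ℤ.* ((+ 4 ℤ.+ w) ℤ.* + D y m)    ≡⟨ cong₂ (λ a b → a ℤ.+ (+ 2 ℤ.+ w) ℤ.* b) e d ⟩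
          pow (suc m) ℤ.+ sgn (suc m) ℤ.* (+ 3 ℤ.+ w) ℤ.+ (+ 2 ℤ.+ w) ℤ.* (pow (suc m) ℤ.+ sgn m)
                                                                                   ≡⟨ solve 3 (λ w a b → a :+ con -[1+ 0 ] :* b :* (con (+ 3) :+ w) :+ (con (+ 2) :+ w) :* (a :+ b) :=
                                                                                         (con (+ 3) :+ w) :* a :+ con -[1+ 0 ] :* b) refl w (pow (suc m)) (sgn m) ⟩
          pow (suc (suc m)) ℤ.+ sgn (suc m)                                        ∎) ,
        (begin
          (+ 4 ℤ.+ w) ℤ.* + E y (suc m)                                            ≡⟨ cong ((+ 4 ℤ.+ w) ℤ.*_) (+E m) ⟩
          (+ 4 ℤ.+ w) ℤ.* ((+ 3 ℤ.+ w) ℤ.* + D y m)                                ≡⟨ solve 2 (λ w d → (con (+ 4) :+ w) :* ((con (+ 3) :+ w) :* d) :=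
                                                                                         (con (+ 3) :+ w) :* ((con (+ 4) :+ w) :* d)) refl w (+ D y m) ⟩
          (+ 3 ℤ.+ w) ℤ.* ((+ 4 ℤ.+ w) ℤ.* + D y m)                                ≡⟨ cong ((+ 3 ℤ.+ w) ℤ.*_) d ⟩
          (+ 3 ℤ.+ w) ℤ.* (pow (suc m) ℤ.+ sgn m)                                  ≡⟨ solve 3 (λ w a b → (con (+ 3) :+ w) :* (a :+ b) :=
                                                                                         (con (+ 3) :+ w) :* a :+ con -[1+ 0 ] :* (con -[1+ 0 ] :* b) :* (con (+ 3) :+ w)) refl w (pow (suc m)) (sgn m) ⟩
          pow (suc (suc m)) ℤ.+ sgn (suc (suc m)) ℤ.* (+ 3 ℤ.+ w)                  ∎)
      where
      open ≡-Reasoning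
      open ℤ-Solver

  -- The factor `x` by which the falling factorials on the two sides differ is exactly the one that
  -- `closed` needs.
  bound≡ : ∀ k p → bound (suc k + p) (suc k) (4 + y) ≡ + (falling (4 + y) (suc k) * D y p)
  bound≡ k p rewrite m+n∸m≡n (suc k) p | +-comm p 1 = begin
    + f ℤ.* (+ ((3 + y) ^ suc p) ℤ.+ sgn p)       ≡⟨ cong (λ a → + f ℤ.* (a ℤ.+ sgn p)) (pos-pow (suc p)) ⟩
    + f ℤ.* (pow (suc p) ℤ.+ sgn p)               ≡⟨ cong (λ a → + f ℤ.* a) (proj₁ (closed p)) ⟨
    + f ℤ.* (+ (4 + y) ℤ.* + D y p)               ≡⟨ cong (λ a → + f ℤ.* a) (ℤ.pos-* (4 + y) (D y p)) ⟨
    + f ℤ.* + ((4 + y) * D y p)                   ≡⟨ ℤ.pos-* f ((4 + y) * D y p) ⟨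
    + (f * ((4 + y) * D y p))                     ≡⟨ cong +_ (solve 3 (λ a b c → a :* (b :* c) := b :* a :* c) refl f (4 + y) (D y p)) ⟩
    + ((4 + y) * f * D y p)                       ∎
    where
    open ≡-Reasoning
    open +-*-Solver
    f = falling (3 + y) k

private
  -- The alternative of a strict inequality or `A` yields both the bound and its equality case,
  -- provided that `A` forces equality.
  compare-to-bound : ∀ {P B : ℕ} {b : ℤ} {A : Set} → b ≡ + B → (A → P ≡ B) → P < B ⊎ A →
    (+ P ≤ℤ b) × ((+ P ≡ b) ⇔ A)
  compare-to-bound refl attained (inj₁ P<B) =
    ℤ.+≤+ (<⇒≤ P<B) , mk⇔ (λ e → ⊥-elim (<⇒≢ P<B (ℤ.+-injective e))) (cong +_ ∘ attained)
  compare-to-bound refl attained (inj₂ a) =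
    ℤ.≤-reflexive (cong +_ (attained a)) , mk⇔ (λ _ → a) (cong +_ ∘ attained)

  P≡-Gnk : ∀ j q y (G : Graph (2 + j + suc q)) → G ≅ Gnk (2 + j + suc q) (2 + j) →
    P G (4 + y) ≡ falling (4 + y) (2 + j) * D y (suc q)
  P≡-Gnk j q y G iso = trans (P-≅ {G = G} {Gnk (2 + j + suc q) (2 + j)} iso (Vec.replicate (2 + j + suc q) zero))
    (GnkStructure.P-Gnk j q y)

  -- The shapes of `k`, `n` and `x` are given by equations, so that matching on `refl` removes all
  -- truncated differences at once.
  main : ∀ j q y {k n x} → 2 + j ≡ k → k + suc q ≡ n → 4 + y ≡ x → (G : Graph n) →
    TwoConnected G → HasClique G k → k ≤ x →
    ((+ P G x) ≤ℤ bound n k x) × (((+ P G x) ≡ bound n k x) ⇔ (G ≅ Gnk n k))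
  main j q y refl refl refl G 2c hasClique k≤x = compare-to-bound
    {P G (4 + y)} {falling (4 + y) (2 + j) * D y (suc q)} {bound (2 + j + suc q) (2 + j) (4 + y)}
    (bound≡ y (suc j) (suc q)) (P≡-Gnk j q y G) (extremal j q y G 2c hasClique k≤x)

theorem2p8 : (k n : ℕ) → 4 ≤ k → k < n → (G : Graph n) →
    TwoConnected G → ChromaticNumberIs G k → CliqueNumberIs G k →
    (x : ℕ) → k ≤ x →
    ((+ P G x) ≤ℤ bound n k x) × (((+ P G x) ≡ bound n k x) ⇔ (G ≅ Gnk n k))
theorem2p8 k n 4≤k k<n G 2c _ (hasClique , _) x k≤x =
  let j , 2+j≡k = m≤n⇒∃[o]m+o≡n (≤-trans (s≤s (s≤s z≤n)) 4≤k)
      q , k+q≡n = m≤n⇒∃[o]m+o≡n k<n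
      y , 4+y≡x = m≤n⇒∃[o]m+o≡n (≤-trans 4≤k k≤x)
  in main j q y 2+j≡k (trans (+-suc k q) k+q≡n) 4+y≡x G 2c hasClique k≤x
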